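{- A connected graph $\Gamma$ is a locally-finite connected-homogeneous bipartite graph if and only if $\Gamma$ is isomorphic to one of the following: a cycle $C_m$ with $m$ even; an infinite semiregular tree $T_{a,b}$ ($a,b\in\mathbb{N}$); a complete bipartite graph $K_{m,n}$ ($m,n\in\mathbb{N}$); the complement of a perfect matching.
   Context: Let $\Gamma$ be a bipartite graph with a given bipartition $X\cup Y$. An automorphism of the bipartite graph is a graph automorphism $\varphi$ with $\varphi(X)=X$, $\varphi(Y)=Y$. $\Gamma$ is a connected-homogeneous bipartite graph if every isomorphism between finite connected induced subgraphs that maps vertices of $X$ to vertices of $X$ and vertices of $Y$ to vertices of $Y$ extends to an automorphism of the bipartite graph $\Gamma$. Locally-finite means every vertex has finite degree. $T_{a,b}$ denotes the infinite tree in which every vertex of one part of the bipartition has degree $a$ and every vertex of the other has degree $b$. The complement of a perfect matching on $2n$ vertices is the bipartite graph with parts $X,Y$ of size $n$, a bijection $\eta:X\to Y$, and $x\sim y$ iff $y\neq\eta(x)$. -}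

module Defs where

open import Level using (Level; _⊔_; 0ℓ) renaming (suc to lsuc)
open import Data.Empty using (⊥)
open import Data.Fin using (Fin; toℕ)
open import Data.Fin.Permutation using (Permutation′; _⟨$⟩ʳ_)
open import Data.List using (List; length)
open import Data.List.Membership.Propositional using (_∈_)
open import Data.List.Relation.Unary.Unique.Propositional using (Unique)
open import Data.Nat using (ℕ; suc; _≤_; s≤s)
open import Data.Nat.Properties using (1+n≢n)
open import Data.Product using (Σ; Σ-syntax; ∃; _×_; _,_; proj₁)
open import Data.Sum using (_⊎_; inj₁; inj₂; swap)
open import Data.Unit using (⊤)
open import Function.Bundles using (_↔_; _⇔_; Inverse)
open import Function.Definitions using (Injective)
open import Relation.Binary.Core using (Rel)
open import Relation.Binary.Construct.Closure.ReflexiveTransitive using (Star)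
open import Relation.Binary.Definitions using (Symmetric)
open import Relation.Binary.PropositionalEquality using (_≡_; _≢_)
open import Relation.Nullary using (¬_)

private
  variable
    ℓ ℓ₁ ℓ₂ : Level

------------------------------------------------------------------------
-- Simple graphs

-- Only the inhabitation of u ~ v matters; it need not be a proposition.
record Graph (ℓ : Level) : Set (lsuc ℓ) where
  infix 4 _~_
  field
    Vertex   : Set ℓ
    _~_      : Rel Vertex ℓ
    ~-sym    : Symmetric _~_
    ~-irrefl : ∀ {v} → ¬ (v ~ v)

open Graph public using (Vertex)

infix 4 _≅_
record _≅_ (G : Graph ℓ₁) (H : Graph ℓ₂) : Set (ℓ₁ ⊔ ℓ₂) where
  private
    module G = Graph G
    module H = Graph H
  field
    bijection : G.Vertex ↔ H.Vertex

  to : G.Vertex → H.Vertex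
  to = Inverse.to bijection

  field
    adjacency : ∀ u v → u G.~ v ⇔ to u H.~ to v

Connected : Graph ℓ → Set ℓ
Connected G = ∀ u v → Star (Graph._~_ G) u v

HasDegree : (G : Graph ℓ) → Vertex G → ℕ → Set ℓ
HasDegree G v d =
  Σ[ ns ∈ List (Vertex G) ]
    Unique ns × length ns ≡ d × (∀ u → u ∈ ns ⇔ v ~ u)
  where open Graph G using (_~_)

LocallyFinite : Graph ℓ → Set ℓ
LocallyFinite G = ∀ v → ∃ (HasDegree G v)

Infinite : Graph ℓ → Set ℓ
Infinite G = ¬ (Σ[ vs ∈ List (Vertex G) ] (∀ v → v ∈ vs))

------------------------------------------------------------------------
-- Induced subgraphs

-- The absence of repetitions makes membership in the list a proposition,
-- so that each element of the subset gives exactly one vertex of the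
-- induced subgraph.
record FiniteSubset (A : Set ℓ) : Set ℓ where
  field
    elements : List A
    unique   : Unique elements

induced : (G : Graph ℓ) → FiniteSubset (Vertex G) → Graph ℓ
induced G S = record
  { Vertex   = Σ[ v ∈ G.Vertex ] (v ∈ FiniteSubset.elements S)
  ; _~_      = λ u v → proj₁ u G.~ proj₁ v
  ; ~-sym    = G.~-sym
  ; ~-irrefl = G.~-irrefl
  }
  where module G = Graph G

------------------------------------------------------------------------
-- Bipartitions and connected-homogeneity

data Part : Set where
  X Y : Part

-- A part is allowed to be empty.
record Bipartition (G : Graph ℓ) : Set ℓ where
  open Graph G using (_~_)
  field
    part   : Vertex G → Part
    proper : ∀ {u v} → u ~ v → part u ≢ part v

-- For a bijection φ of the vertices, preserving the part of each vertex
-- amounts to φ(X) = X and φ(Y) = Y.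
record BipartiteAutomorphism {G : Graph ℓ} (P : Bipartition G) : Set ℓ where
  open Bipartition P using (part)
  field
    automorphism : G ≅ G
  open _≅_ automorphism public using (to)
  field
    preserves : ∀ v → part (to v) ≡ part v

ConnectedHomogeneous : (G : Graph ℓ) → Bipartition G → Set ℓ
ConnectedHomogeneous G P =
  (A B : FiniteSubset (Vertex G)) →
  Connected (induced G A) → Connected (induced G B) →
  (φ : induced G A ≅ induced G B) →
  (∀ a → part (proj₁ (_≅_.to φ a)) ≡ part (proj₁ a)) →
  Σ[ ψ ∈ BipartiteAutomorphism P ]
    (∀ a → BipartiteAutomorphism.to ψ (proj₁ a) ≡ proj₁ (_≅_.to φ a))
  where open Bipartition P using (part)

-- Only the existence of a suitable bipartition is asked for; a connected
-- graph has at most one up to exchanging the two parts.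
IsConnectedHomogeneousBipartite : Graph ℓ → Set ℓ
IsConnectedHomogeneousBipartite G =
  Σ[ P ∈ Bipartition G ] ConnectedHomogeneous G P

------------------------------------------------------------------------
-- Cycles and trees

-- j is the successor of i modulo m.
Next : (m : ℕ) → Rel (Fin m) 0ℓ
Next m i j = suc (toℕ i) ≡ toℕ j ⊎ (suc (toℕ i) ≡ m × toℕ j ≡ 0)

Cycle : (m : ℕ) → 3 ≤ m → Graph 0ℓ
Cycle m 3≤m = record
  { Vertex   = Fin m
  ; _~_      = λ i j → Next m i j ⊎ Next m j i
  ; ~-sym    = swap
  ; ~-irrefl = λ { (inj₁ p) → ¬loop 3≤m p ; (inj₂ p) → ¬loop 3≤m p }
  }
  where
  ¬loop : ∀ {m} → 3 ≤ m → {i : Fin m} → ¬ Next m i i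
  ¬loop _ (inj₁ p) = 1+n≢n p
  ¬loop (s≤s (s≤s _)) {Fin.zero} (inj₂ (() , _))
  ¬loop _ {Fin.suc _} (inj₂ (_ , ()))

-- No cycle occurs as a (not necessarily induced) subgraph.
Acyclic : Graph ℓ → Set ℓ
Acyclic G =
  ∀ m (3≤m : 3 ≤ m) →
  ¬ (Σ[ f ∈ (Fin m → Vertex G) ]
      Injective _≡_ _≡_ f ×
      (∀ i j → Graph._~_ (Cycle m 3≤m) i j → Graph._~_ G (f i) (f j)))

-- T is (a copy of) the infinite tree T_{a,b}.  Being infinite forces
-- a , b ≥ 2.
IsInfiniteSemiregularTree : ℕ → ℕ → Graph ℓ → Set ℓ
IsInfiniteSemiregularTree a b T =
  Connected T × Acyclic T × Infinite T ×
  (Σ[ P ∈ Bipartition T ]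
    (∀ v → Bipartition.part P v ≡ X → HasDegree T v a) ×
    (∀ v → Bipartition.part P v ≡ Y → HasDegree T v b))

------------------------------------------------------------------------
-- Finite bipartite graphs given by an incidence relation

BipartiteGraph : (m n : ℕ) → (Fin m → Fin n → Set) → Graph 0ℓ
BipartiteGraph m n R = record
  { Vertex   = Fin m ⊎ Fin n
  ; _~_      = adj
  ; ~-sym    = λ {u} {v} → adj-sym u v
  ; ~-irrefl = λ {v} → adj-irrefl v
  }
  where
  adj : Rel (Fin m ⊎ Fin n) 0ℓ
  adj (inj₁ i) (inj₂ j) = R i j
  adj (inj₂ j) (inj₁ i) = R i j
  adj (inj₁ _) (inj₁ _) = ⊥
  adj (inj₂ _) (inj₂ _) = ⊥

  adj-sym : ∀ u v → adj u v → adj v u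
  adj-sym (inj₁ _) (inj₂ _) r = r
  adj-sym (inj₂ _) (inj₁ _) r = r

  adj-irrefl : ∀ v → ¬ adj v v
  adj-irrefl (inj₁ _) ()
  adj-irrefl (inj₂ _) ()

-- m and n may be 0; in particular K_{1,0} is the one-vertex graph.
CompleteBipartite : ℕ → ℕ → Graph 0ℓ
CompleteBipartite m n = BipartiteGraph m n (λ _ _ → ⊤)

ComplementOfPerfectMatching : (n : ℕ) → Permutation′ n → Graph 0ℓ
ComplementOfPerfectMatching n η = BipartiteGraph n n (λ x y → y ≢ η ⟨$⟩ʳ x)

{-# OPTIONS --safe #-}
module Submission where

-- Only if.  If every walk a b c d satisfies a ~ d, then Γ is complete bipartite;
-- otherwise every vertex has two neighbours.
-- If Γ contains a square, permuting the star at a vertex shows that of two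
-- vertices with a common neighbour, each misses exactly one neighbour of the
-- other, and Γ is the complement of a perfect matching.
-- If Γ contains no square but some vertex has three neighbours, then the
-- third neighbour of a vertex on a shortest closed path yields a hexagon, and a
-- hexagon is incompatible with homogeneity; so Γ is a tree.
-- If no vertex has three neighbours, then Γ is a tree or a cycle.
--
-- If.  For trees, complete bipartite graphs and complements of perfect
-- matchings, a partial isomorphism with connected domain extends to any further
-- vertex adjacent to its domain; the limit of such extensions is an injective
-- homomorphism preserving degrees, hence surjective.  For cycles, the dihedral
-- group is transitive on arcs, and two consecutive vertices determine an
-- isomorphism of connected induced subgraphs.

open import Defs
open import Level using (Level; 0ℓ) renaming (suc to lsuc)
open import Axiom.ExcludedMiddle using (ExcludedMiddle)
open import Data.Empty using (⊥; ⊥-elim)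
open import Data.Unit using (⊤; tt)
open import Data.Fin using (Fin; zero; suc; toℕ; fromℕ; fromℕ<; inject₁; opposite; punchIn; punchOut)
import Data.Fin.Properties as Fin
open import Data.Fin.Induction using (<-weakInduction)
open import Data.Fin.Permutation using (Permutation′; _⟨$⟩ʳ_; _⟨$⟩ˡ_; inverseˡ; inverseʳ)
import Data.Fin.Permutation as Perm
open import Data.List using (List; []; _∷_; length; map; filter; lookup; tabulate; allFin; concatMap; _++_; _∷ʳ_)
open import Data.List.Properties using (filter-notAll; length-map; length-++; length-tabulate)
open import Data.List.Membership.Propositional using (_∈_; _∉_; lose)
open import Data.List.Membership.Propositional.Properties using (∈-map⁺; ∈-map⁻; ∈-filter⁺; ∈-filter⁻; ∈-tabulate⁻; ∈-lookup; ∈-concatMap⁺; ∈-allFin; ∈-++⁺ˡ; ∈-++⁺ʳ; ∈-++⁻)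
open import Data.List.Membership.Propositional.Properties.WithK using (unique⇒irrelevant)
open import Data.List.Relation.Binary.Subset.Propositional using (_⊆_)
open import Data.List.Relation.Unary.All as All using (All; []; _∷_)
open import Data.List.Relation.Unary.All.Properties using (¬Any⇒All¬; All¬⇒¬Any)
open import Data.List.Relation.Unary.AllPairs using ([]; _∷_)
open import Data.List.Relation.Unary.Any as Any using (Any; here; there; index)
open import Data.List.Relation.Unary.Any.Properties using (lookup-index)
open import Data.List.Relation.Unary.Unique.Propositional using (Unique)
import Data.List.Relation.Unary.Unique.Propositional.Properties as Unique
open import Data.Nat using (ℕ; zero; suc; pred; _+_; _*_; _∸_; _≤_; _<_; z≤n; s≤s)
import Data.Nat.Properties as ℕ
open import Data.Nat.Divisibility using (_∣_; divides)
open import Data.Product using (Σ; Σ-syntax; ∃; ∃-syntax; _×_; _,_; proj₁; proj₂)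
open import Data.Sum using (_⊎_; inj₁; inj₂; [_,_]; [_,_]′)
open import Function using (_∘_; id)
open import Function.Bundles using (_⇔_; Inverse; Equivalence; mk↔ₛ′; mk⇔)
open import Function.Definitions using (Injective)
open import Relation.Binary.Construct.Closure.ReflexiveTransitive using (Star; ε; _◅_; _◅◅_; gmap)
open import Relation.Binary.Definitions using (DecidableEquality)
open import Relation.Binary.PropositionalEquality using (_≡_; _≢_; refl; sym; trans; cong; subst; subst₂; ≢-sym)
open import Relation.Nullary using (¬_; Dec; yes; no)
open import Relation.Nullary.Decidable using (¬?; decidable-stable)

-- Automorphisms preserve the parts, so homogeneity never compares a vertex of `X` with a vertex of
-- `Y`; in T_{2,3} the parts really differ. Every local property is therefore transported within
-- each part separately, and the configurations used (edge, four-vertex path, square, hexagon) must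
-- serve both parts, if necessary after a shift by one step.
--
-- A star, or a path with two edges, is automatically induced, since vertices of one part are never
-- adjacent; homogeneity applies to it at once. For larger configurations the absence of further
-- adjacencies has to be earned: from parity, from the absence of squares, or from the minimality of
-- a closed path. That is why the square-free case works on a shortest closed path: its first two
-- vertices can be moved while the rest stays fixed, and the old and new copies together with the
-- two vertices they are attached to form the hexagon.
--
-- In the converse, extensions proceed in one direction only. Degrees depend on the part alone, and
-- counting neighbours supplies both a free image for each new vertex (for all but the cycles) and
-- the surjectivity of the limit.

other : Part → Part
other X = Y
other Y = X

other-≢ : ∀ p → other p ≢ p
other-≢ X ()
other-≢ Y ()

≢⇒other : ∀ {p q : Part} → p ≢ q → q ≡ other p
≢⇒other {X} {X} ne = ⊥-elim (ne refl)
≢⇒other {X} {Y} _  = refl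
≢⇒other {Y} {X} _  = refl
≢⇒other {Y} {Y} ne = ⊥-elim (ne refl)

≢-≢⇒≡ : ∀ {p q r : Part} → p ≢ q → q ≢ r → p ≡ r
≢-≢⇒≡ {X} {X} p≢q _ = ⊥-elim (p≢q refl)
≢-≢⇒≡ {X} {Y} {X} _ _ = refl
≢-≢⇒≡ {X} {Y} {Y} _ q≢r = ⊥-elim (q≢r refl)
≢-≢⇒≡ {Y} {X} {X} _ q≢r = ⊥-elim (q≢r refl)
≢-≢⇒≡ {Y} {X} {Y} _ _ = refl
≢-≢⇒≡ {Y} {Y} p≢q _ = ⊥-elim (p≢q refl)

_≟ᴾ_ : DecidableEquality Part
X ≟ᴾ X = yes refl
X ≟ᴾ Y = no λ ()
Y ≟ᴾ X = no λ ()
Y ≟ᴾ Y = yes refl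

∉⇒All≢ : ∀ {a} {A : Set a} {x : A} {xs} → x ∉ xs → All (x ≢_) xs
∉⇒All≢ = ¬Any⇒All¬ _

All≢⇒∉ : ∀ {a} {A : Set a} {x : A} {xs} → All (x ≢_) xs → x ∉ xs
All≢⇒∉ = All¬⇒¬Any

lookup-injective : ∀ {a} {A : Set a} {xs : List A} → Unique xs → Injective _≡_ _≡_ (lookup xs)
lookup-injective (x∉xs ∷ _) {zero}  {zero}  _  = refl
lookup-injective (x∉xs ∷ _) {zero}  {suc j} eq = ⊥-elim (All.lookup x∉xs (∈-lookup j) eq)
lookup-injective (x∉xs ∷ _) {suc i} {zero}  eq = ⊥-elim (All.lookup x∉xs (∈-lookup i) (sym eq))
lookup-injective (_ ∷ uniq) {suc i} {suc j} eq = cong suc (lookup-injective uniq eq)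

-- Pigeonhole counting and transpositions

module Counting {a} {A : Set a} (_≟_ : DecidableEquality A) where

  infixl 6 _without_
  _without_ : List A → A → List A
  xs without x = filter (λ y → ¬? (y ≟ x)) xs

  ∈-without⁺ : ∀ {x y xs} → y ∈ xs → y ≢ x → y ∈ xs without x
  ∈-without⁺ {x} = ∈-filter⁺ (λ y → ¬? (y ≟ x))

  ∈-without⁻ : ∀ {x y xs} → y ∈ xs without x → y ∈ xs × y ≢ x
  ∈-without⁻ {x} = ∈-filter⁻ (λ y → ¬? (y ≟ x))

  without-unique : ∀ {x xs} → Unique xs → Unique (xs without x)
  without-unique {x} = Unique.filter⁺ (λ y → ¬? (y ≟ x))

  length-without : ∀ {x} xs → x ∈ xs → length (xs without x) < length xs
  length-without {x} xs x∈xs =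
    filter-notAll (λ y → ¬? (y ≟ x)) xs (Any.map (λ x≡y y≢x → y≢x (sym x≡y)) x∈xs)

  ⊆⇒length≤ : ∀ {xs ys} → Unique xs → xs ⊆ ys → length xs ≤ length ys
  ⊆⇒length≤ {[]} _ _ = z≤n
  ⊆⇒length≤ {x ∷ xs} {ys} (x∉xs ∷ uniq) sub =
    ℕ.≤-trans (s≤s (⊆⇒length≤ uniq λ z∈xs →
                 ∈-without⁺ (sub (there z∈xs)) (λ z≡x → All.lookup x∉xs z∈xs (sym z≡x))))
              (length-without ys (sub (here refl)))

  transpose : A → A → A → A
  transpose a b x with x ≟ a | x ≟ b
  ... | yes _ | _     = b
  ... | no _  | yes _ = a
  ... | no _  | no _  = x

  transpose-left : ∀ a b → transpose a b a ≡ b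
  transpose-left a b with a ≟ a
  ... | yes _  = refl
  ... | no a≢a = ⊥-elim (a≢a refl)

  transpose-right : ∀ a b → transpose a b b ≡ a
  transpose-right a b with b ≟ a | b ≟ b
  ... | yes b≡a | _      = b≡a
  ... | no _    | yes _  = refl
  ... | no _    | no b≢b = ⊥-elim (b≢b refl)

  transpose-other : ∀ a b {x} → x ≢ a → x ≢ b → transpose a b x ≡ x
  transpose-other a b {x} x≢a x≢b with x ≟ a | x ≟ b
  ... | yes x≡a | _       = ⊥-elim (x≢a x≡a)
  ... | no _    | yes x≡b = ⊥-elim (x≢b x≡b)
  ... | no _    | no _    = refl

  transpose-involutive : ∀ a b x → transpose a b (transpose a b x) ≡ x
  transpose-involutive a b x with x ≟ a | x ≟ b
  ... | yes refl | _        = transpose-right x b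
  ... | no _     | yes refl = transpose-left a x
  ... | no x≢a   | no x≢b   = transpose-other a b x≢a x≢b

  update : ∀ {b} {B : Set b} → (A → B) → A → B → A → B
  update f v w x with x ≟ v
  ... | yes _ = w
  ... | no _  = f x

  update-self : ∀ {b} {B : Set b} (f : A → B) v w → update f v w v ≡ w
  update-self f v w with v ≟ v
  ... | yes _  = refl
  ... | no v≢v = ⊥-elim (v≢v refl)

  update-other : ∀ {b} {B : Set b} (f : A → B) v w {x} → x ≢ v → update f v w x ≡ f x
  update-other f v w {x} x≢v with x ≟ v
  ... | yes x≡v = ⊥-elim (x≢v x≡v)
  ... | no _    = refl

-- Simple paths and closed paths

module Paths {ℓ : Level} (Γ : Graph ℓ) where

  open Graph Γ using (_~_; ~-sym; ~-irrefl)

  data Path : Vertex Γ → Vertex Γ → List (Vertex Γ) → Set ℓ where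
    stop : ∀ {a} → Path a a (a ∷ [])
    go   : ∀ {a b c l} → a ~ b → a ∉ l → Path b c l → Path a c (a ∷ l)

  start∈ : ∀ {a c l} → Path a c l → a ∈ l
  start∈ stop       = here refl
  start∈ (go _ _ _) = here refl

  end∈ : ∀ {a c l} → Path a c l → c ∈ l
  end∈ stop       = here refl
  end∈ (go _ _ p) = there (end∈ p)

  path-unique : ∀ {a c l} → Path a c l → Unique l
  path-unique stop         = [] ∷ []
  path-unique (go _ a∉l p) = ∉⇒All≢ a∉l ∷ path-unique p

  prefix : ∀ {a c l r} → Path a c l → r ∈ l →
           ∃[ l′ ] Path a r l′ × l′ ⊆ l × length l′ ≤ length l
  prefix stop         (here refl) = _ , stop , id , ℕ.≤-refl
  prefix (go _ _ _)   (here refl) = _ , stop , (λ { (here refl) → here refl }) , s≤s z≤n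
  prefix (go e a∉l p) (there r∈l) with prefix p r∈l
  ... | l′ , p′ , sub , len =
    _ , go e (a∉l ∘ sub) p′ , (λ { (here refl) → here refl ; (there z) → there (sub z) }) , s≤s len

  suffix : ∀ {a c l r} → Path a c l → r ∈ l → ∃[ l′ ] Path r c l′ × l′ ⊆ l
  suffix stop         (here refl) = _ , stop , id
  suffix p@(go _ _ _) (here refl) = _ , p , id
  suffix (go _ _ p)   (there r∈l) with suffix p r∈l
  ... | l′ , p′ , sub = l′ , p′ , there ∘ sub

  snoc : ∀ {a b c l} → Path a b l → b ~ c → c ∉ l → Path a c (l ∷ʳ c)
  snoc stop e c∉ = go e (λ { (here refl) → c∉ (here refl) }) stop
  snoc {c = c} (go {l = l} e a∉l p) e′ c∉ =
    go e (λ a∈ → [ a∉l , (λ { (here refl) → c∉ (here refl) }) ] (∈-++⁻ l a∈))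
       (snoc p e′ (c∉ ∘ there))

  length-path : ∀ {a c l} → Path a c l → a ≢ c → 2 ≤ length l
  length-path stop                  a≢c = ⊥-elim (a≢c refl)
  length-path (go _ _ stop)         _   = s≤s (s≤s z≤n)
  length-path (go _ _ (go _ _ _))   _   = s≤s (s≤s z≤n)

  path-lookup : ∀ {a c l} → Path a c l → ∀ i j → suc (toℕ i) ≡ toℕ j → lookup l i ~ lookup l j
  path-lookup (go e _ stop)       zero    (suc zero) _  = e
  path-lookup (go e _ (go _ _ _)) zero    (suc zero) _  = e
  path-lookup (go _ _ p)          (suc i) (suc j)    eq = path-lookup p i j (ℕ.suc-injective eq)
  path-lookup stop                zero    zero       ()

  path-first : ∀ {a c l} → Path a c l → ∀ j → toℕ j ≡ 0 → lookup l j ≡ a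
  path-first stop       zero _ = refl
  path-first (go _ _ _) zero _ = refl

  path-last : ∀ {a c l} → Path a c l → ∀ i → suc (toℕ i) ≡ length l → lookup l i ≡ c
  path-last stop       zero    _  = refl
  path-last (go _ _ p) (suc i) eq = path-last p i (ℕ.suc-injective eq)
  path-last (go _ _ stop)       zero ()
  path-last (go _ _ (go _ _ _)) zero ()

  -- A cycle cut open at the edge `c ~ a`; this form of acyclicity avoids arithmetic modulo the
  -- length.
  NoClosedPath : Set ℓ
  NoClosedPath = ∀ {a c l} → Path a c l → c ~ a → 3 ≤ length l → ⊥

  acyclic⇒no-closed-path : Acyclic Γ → NoClosedPath
  acyclic⇒no-closed-path acyclic {l = l} p e 3≤ =
    acyclic (length l) 3≤ (lookup l , lookup-injective (path-unique p) , adj)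
    where
    next : ∀ i j → Next (length l) i j → lookup l i ~ lookup l j
    next i j (inj₁ eq)          = path-lookup p i j eq
    next i j (inj₂ (eqi , eqj)) =
      subst₂ _~_ (sym (path-last p i eqi)) (sym (path-first p j eqj)) e
    adj : ∀ i j → Graph._~_ (Cycle (length l) 3≤) i j → lookup l i ~ lookup l j
    adj i j (inj₁ n) = next i j n
    adj i j (inj₂ n) = ~-sym (next j i n)

  tabulate-path : ∀ k (g : Fin (suc k) → Vertex Γ) → Injective _≡_ _≡_ g →
                  (∀ i → g (inject₁ i) ~ g (suc i)) → Path (g zero) (g (fromℕ k)) (tabulate g)
  tabulate-path zero    g inj adj = stop
  tabulate-path (suc k) g inj adj =
    go (adj zero) g0∉ (tabulate-path k (g ∘ suc) (λ eq → Fin.suc-injective (inj eq)) (adj ∘ suc))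
    where
    g0∉ : g zero ∉ tabulate (g ∘ suc)
    g0∉ g0∈ with ∈-tabulate⁻ {f = g ∘ suc} g0∈
    ... | i , eq with inj {zero} {suc i} eq
    ...   | ()

  no-closed-path⇒acyclic : NoClosedPath → Acyclic Γ
  no-closed-path⇒acyclic none (suc k) 3≤m (f , inj , adj) =
    none (tabulate-path k f inj
            (λ i → adj _ _ (inj₁ (inj₁ (cong suc (Fin.toℕ-inject₁ i))))))
         (adj _ _ (inj₁ (inj₂ (cong suc (Fin.toℕ-fromℕ k) , refl))))
         (subst (3 ≤_) (sym (length-tabulate f)) 3≤m)

  Inside : List (Vertex Γ) → Vertex Γ → Vertex Γ → Set ℓ
  Inside A u v = u ~ v × u ∈ A × v ∈ A

  -- Loop erasure: if `u` already occurs on the path built from the rest of the walk, only the piece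
  -- of that path from `u` on is kept.
  walk⇒path : ExcludedMiddle ℓ → ∀ {A u v} → u ∈ A → Star (Inside A) u v →
              ∃[ l ] Path u v l × l ⊆ A
  walk⇒path em u∈A ε = _ , stop , λ { (here refl) → u∈A }
  walk⇒path em {A} {u} u∈A ((e , _ , w∈A) ◅ ws) with walk⇒path em w∈A ws
  ... | l , p , sub with em {u ∈ l}
  ...   | no u∉l = _ , go e u∉l p , λ { (here refl) → u∈A ; (there z) → sub z }
  ...   | yes u∈l with suffix p u∈l
  ...     | l′ , p′ , sub′ = l′ , p′ , sub ∘ sub′

-- Extension of partial isomorphisms

Σ-∈-≡ : ∀ {a} {A : Set a} {xs : List A} {u v : A} {u∈ : u ∈ xs} {v∈ : v ∈ xs} → Unique xs → u ≡ v →
        _≡_ {A = Σ A (_∈ xs)} (u , u∈) (v , v∈)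
Σ-∈-≡ uniq refl = cong (_ ,_) (unique⇒irrelevant uniq _ _)

module Isomorphism {ℓ₁ ℓ₂ : Level} {G : Graph ℓ₁} {H : Graph ℓ₂} (ι : G ≅ H) where

  private
    module G = Graph G
    module H = Graph H

  open _≅_ ι public using (to)

  from : H.Vertex → G.Vertex
  from = Inverse.from (_≅_.bijection ι)

  to∘from : ∀ v → to (from v) ≡ v
  to∘from = Inverse.strictlyInverseˡ (_≅_.bijection ι)

  from∘to : ∀ v → from (to v) ≡ v
  from∘to = Inverse.strictlyInverseʳ (_≅_.bijection ι)

  to-injective : ∀ {u v} → to u ≡ to v → u ≡ v
  to-injective eq = trans (sym (from∘to _)) (trans (cong from eq) (from∘to _))

  to-~ : ∀ {u v} → u G.~ v → to u H.~ to v
  to-~ = Equivalence.to (_≅_.adjacency ι _ _)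

  to-~⁻ : ∀ {u v} → to u H.~ to v → u G.~ v
  to-~⁻ = Equivalence.from (_≅_.adjacency ι _ _)

  from-~ : ∀ {u v} → u H.~ v → from u G.~ from v
  from-~ e = to-~⁻ (subst₂ H._~_ (sym (to∘from _)) (sym (to∘from _)) e)

  from-~⁻ : ∀ {u v} → from u G.~ from v → u H.~ v
  from-~⁻ e = subst₂ H._~_ (to∘from _) (to∘from _) (to-~ e)

≅-refl : ∀ {ℓ} {G : Graph ℓ} → G ≅ G
≅-refl = record
  { bijection = mk↔ₛ′ id id (λ _ → refl) (λ _ → refl)
  ; adjacency = λ _ _ → mk⇔ id id
  }

≅-sym : ∀ {ℓ₁ ℓ₂} {G : Graph ℓ₁} {H : Graph ℓ₂} → G ≅ H → H ≅ G
≅-sym ι = record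
  { bijection = mk↔ₛ′ from to from∘to to∘from
  ; adjacency = λ _ _ → mk⇔ from-~ from-~⁻
  }
  where open Isomorphism ι

≅-trans : ∀ {ℓ₁ ℓ₂ ℓ₃} {G : Graph ℓ₁} {H : Graph ℓ₂} {K : Graph ℓ₃} → G ≅ H → H ≅ K → G ≅ K
≅-trans ι κ = record
  { bijection = mk↔ₛ′ (κ.to ∘ ι.to) (ι.from ∘ κ.from)
      (λ v → trans (cong κ.to (ι.to∘from _)) (κ.to∘from v))
      (λ v → trans (cong ι.from (κ.from∘to _)) (ι.from∘to v))
  ; adjacency = λ _ _ → mk⇔ (κ.to-~ ∘ ι.to-~) (ι.to-~⁻ ∘ κ.to-~⁻)
  }
  where
  module ι = Isomorphism ι
  module κ = Isomorphism κ

module Extension {ℓ : Level} (Γ : Graph ℓ) (P : Bipartition Γ)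
                 (homogeneous : ConnectedHomogeneous Γ P) where

  open Graph Γ using (_~_; ~-sym; ~-irrefl)
  open Bipartition P using (part; proper)

  ~⇒≢ : ∀ {u v} → u ~ v → u ≢ v
  ~⇒≢ e refl = ~-irrefl e

  same-part : ∀ {u v w} → v ~ u → v ~ w → part u ≡ part w
  same-part e e′ = ≢-≢⇒≡ (proper (~-sym e)) (proper e′)

  same-part⇒≁ : ∀ {u v} → part u ≡ part v → ¬ u ~ v
  same-part⇒≁ eq e = proper e eq

  -- Connectedness in inductive form: read from its tail, the list gains one vertex at a time,
  -- attached to an earlier one.
  data Grown : List (Vertex Γ) → Set ℓ where
    base : ∀ {a} → Grown (a ∷ [])
    grow : ∀ {a c l} → a ~ c → c ∈ l → a ∉ l → Grown l → Grown (a ∷ l)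

  grown-unique : ∀ {l} → Grown l → Unique l
  grown-unique base             = [] ∷ []
  grown-unique (grow _ _ a∉l g) = ∉⇒All≢ a∉l ∷ grown-unique g

  subset : ∀ {l} → Grown l → FiniteSubset (Vertex Γ)
  subset {l} g = record { elements = l ; unique = grown-unique g }

  grown-connected : ∀ {l} (g : Grown l) → Connected (induced Γ (subset g))
  grown-connected base (_ , here refl) (_ , here refl) = ε
  grown-connected {a ∷ l} (grow {c = c} e c∈l a∉l g) = connected
    where
    old : ∀ u v → Star _ (proj₁ u , there (proj₂ u)) (proj₁ v , there (proj₂ v))
    old u v = gmap (λ (w , w∈) → w , there w∈) id (grown-connected g u v)
    connected : Connected (induced Γ (subset (grow e c∈l a∉l g)))
    connected (_ , here refl) (_ , here refl) = ε
    connected (_ , here refl) (v , there v∈)  = e ◅ old (c , c∈l) (v , v∈)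
    connected (u , there u∈)  (_ , here refl) = old (u , u∈) (c , c∈l) ◅◅ (~-sym e ◅ ε)
    connected (u , there u∈)  (v , there v∈)  = old (u , u∈) (v , v∈)

  Compatible : (p q : Vertex Γ × Vertex Γ) → Set ℓ
  Compatible (a , b) (c , d) = a ≢ c × b ≢ d × (a ~ c ⇔ b ~ d)

  -- Graphs of isomorphisms between connected induced subgraphs.
  data PartialIso : List (Vertex Γ × Vertex Γ) → Set ℓ where
    base : ∀ {a b} → part a ≡ part b → PartialIso ((a , b) ∷ [])
    grow : ∀ {a b c d ps} → PartialIso ps → (c , d) ∈ ps → a ~ c →
           (∀ {q} → q ∈ ps → Compatible (a , b) q) → PartialIso ((a , b) ∷ ps)

  domain-grown : ∀ {ps} → PartialIso ps → Grown (map proj₁ ps)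
  domain-grown (base _) = base
  domain-grown {(a , _) ∷ ps} (grow f cd∈ e compatible) =
    grow e (∈-map⁺ proj₁ cd∈) a∉ (domain-grown f)
    where
    a∉ : a ∉ map proj₁ ps
    a∉ a∈ with ∈-map⁻ proj₁ a∈
    ... | _ , q∈ , eq = proj₁ (compatible q∈) eq

  range-grown : ∀ {ps} → PartialIso ps → Grown (map proj₂ ps)
  range-grown (base _) = base
  range-grown {(_ , b) ∷ ps} (grow f cd∈ e compatible) =
    grow (Equivalence.to (proj₂ (proj₂ (compatible cd∈))) e) (∈-map⁺ proj₂ cd∈) b∉ (range-grown f)
    where
    b∉ : b ∉ map proj₂ ps
    b∉ b∈ with ∈-map⁻ proj₂ b∈
    ... | _ , q∈ , eq = proj₁ (proj₂ (compatible q∈)) eq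

  -- Equality of parts is demanded only of the first pair; every later pair is adjacent to an
  -- earlier one on both sides, so both of its entries switch part.
  pair-part : ∀ {ps a b} → PartialIso ps → (a , b) ∈ ps → part a ≡ part b
  pair-part (base eq)                 (here refl) = eq
  pair-part (grow f cd∈ e compatible) (here refl) =
    ≢-≢⇒≡ (subst (part _ ≢_) (pair-part f cd∈) (proper e))
          (≢-sym (proper (Equivalence.to (proj₂ (proj₂ (compatible cd∈))) e)))
  pair-part (grow f _ _ _)            (there q∈)  = pair-part f q∈

  -- Unlike `Compatible`, this also holds of a pair and itself. Its first two components say that
  -- the list of pairs is the graph of an injective function.
  Coherent : (p q : Vertex Γ × Vertex Γ) → Set ℓ
  Coherent (a , b) (c , d) = (a ≡ c → b ≡ d) × (b ≡ d → a ≡ c) × (a ~ c ⇔ b ~ d)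

  compatible⇒coherent : ∀ p q → Compatible p q → Coherent p q × Coherent q p
  compatible⇒coherent _ _ (a≢c , b≢d , adj) =
    ((⊥-elim ∘ a≢c) , (⊥-elim ∘ b≢d) , adj) ,
    ((λ eq → ⊥-elim (a≢c (sym eq))) , (λ eq → ⊥-elim (b≢d (sym eq))) ,
     mk⇔ (~-sym ∘ Equivalence.to adj ∘ ~-sym) (~-sym ∘ Equivalence.from adj ∘ ~-sym))

  coherent : ∀ {ps p q} → PartialIso ps → p ∈ ps → q ∈ ps → Coherent p q
  coherent _ (here refl) (here refl) =
    (λ _ → refl) , (λ _ → refl) , mk⇔ (⊥-elim ∘ ~-irrefl) (⊥-elim ∘ ~-irrefl)
  coherent (grow f _ _ compatible) (here refl) (there q∈)  = proj₁ (compatible⇒coherent _ _ (compatible q∈))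
  coherent (grow f _ _ compatible) (there p∈)  (here refl) = proj₂ (compatible⇒coherent _ _ (compatible p∈))
  coherent (grow f _ _ _)          (there p∈)  (there q∈)  = coherent f p∈ q∈

  image : ∀ (ps : List (Vertex Γ × Vertex Γ)) {v} → v ∈ map proj₁ ps → ∃[ w ] (v , w) ∈ ps
  image _ v∈ with ∈-map⁻ proj₁ v∈
  ... | _ , q∈ , refl = _ , q∈

  preimage : ∀ (ps : List (Vertex Γ × Vertex Γ)) {w} → w ∈ map proj₂ ps → ∃[ v ] (v , w) ∈ ps
  preimage _ w∈ with ∈-map⁻ proj₂ w∈
  ... | _ , q∈ , refl = _ , q∈

  module _ {ps : List (Vertex Γ × Vertex Γ)} (f : PartialIso ps) where

    domain range : FiniteSubset (Vertex Γ)
    domain = subset (domain-grown f)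
    range  = subset (range-grown f)

    iso : induced Γ domain ≅ induced Γ range
    iso = record
      { bijection = mk↔ₛ′
          (λ (v , v∈) → proj₁ (image ps v∈) , ∈-map⁺ proj₂ (proj₂ (image ps v∈)))
          (λ (w , w∈) → proj₁ (preimage ps w∈) , ∈-map⁺ proj₁ (proj₂ (preimage ps w∈)))
          (λ (w , w∈) → Σ-∈-≡ (FiniteSubset.unique range)
             (proj₁ (coherent f (proj₂ (image ps (∈-map⁺ proj₁ (proj₂ (preimage ps w∈))))) (proj₂ (preimage ps w∈))) refl))
          (λ (v , v∈) → Σ-∈-≡ (FiniteSubset.unique domain)
             (proj₁ (proj₂ (coherent f (proj₂ (preimage ps (∈-map⁺ proj₂ (proj₂ (image ps v∈))))) (proj₂ (image ps v∈)))) refl))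
      ; adjacency = λ (_ , u∈) (_ , v∈) → proj₂ (proj₂ (coherent f (proj₂ (image ps u∈)) (proj₂ (image ps v∈))))
      }

    extend : Σ[ ψ ∈ BipartiteAutomorphism P ] (∀ {a b} → (a , b) ∈ ps → BipartiteAutomorphism.to ψ a ≡ b)
    extend = proj₁ extended , λ {a} ab∈ →
      trans (proj₂ extended (a , ∈-map⁺ proj₁ ab∈))
            (proj₁ (coherent f (proj₂ (image ps (∈-map⁺ proj₁ ab∈))) ab∈) refl)
      where
      extended = homogeneous domain range (grown-connected (domain-grown f)) (grown-connected (range-grown f))
                   iso (λ (_ , a∈) → sym (pair-part f (proj₂ (image ps a∈))))

  module Auto (ψ : BipartiteAutomorphism P) where
    open Isomorphism (BipartiteAutomorphism.automorphism ψ) public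
    preserves : ∀ v → part (to v) ≡ part v
    preserves = BipartiteAutomorphism.preserves ψ

-- Coordinates for bipartite graphs

module _ {ℓ : Level} {Γ : Graph ℓ} (P : Bipartition Γ) where

  open Graph Γ using (_~_; ~-sym)
  open Bipartition P using (part; proper)

  -- The part `p` is left open, so the first coordinate may enumerate either part of the graph.
  bipartite-coordinates :
    ∀ {m n p} {R : Fin m → Fin n → Set} (x : Fin m → Vertex Γ) (y : Fin n → Vertex Γ) →
    Injective _≡_ _≡_ x → Injective _≡_ _≡_ y →
    (∀ i → part (x i) ≡ p) → (∀ j → part (y j) ≢ p) →
    (∀ v → (∃[ i ] x i ≡ v) ⊎ (∃[ j ] y j ≡ v)) →
    (∀ i j → R i j ⇔ x i ~ y j) →
    Γ ≅ BipartiteGraph m n R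
  bipartite-coordinates {m} {n} {R = R} x y x-inj y-inj x-part y-part cover adj = ≅-sym (record
    { bijection = mk↔ₛ′ vertex coordinate vertex∘coordinate
        (λ z → vertex-injective _ _ (vertex∘coordinate (vertex z)))
    ; adjacency = λ u v → mk⇔ (hom u v) (hom⁻ u v)
    })
    where
    open Graph (BipartiteGraph m n R) using () renaming (_~_ to _~′_)

    vertex : Fin m ⊎ Fin n → Vertex Γ
    vertex = [ x , y ]

    coordinate : Vertex Γ → Fin m ⊎ Fin n
    coordinate v with cover v
    ... | inj₁ (i , _) = inj₁ i
    ... | inj₂ (j , _) = inj₂ j

    vertex∘coordinate : ∀ v → vertex (coordinate v) ≡ v
    vertex∘coordinate v with cover v
    ... | inj₁ (_ , eq) = eq
    ... | inj₂ (_ , eq) = eq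

    vertex-injective : ∀ u v → vertex u ≡ vertex v → u ≡ v
    vertex-injective (inj₁ i) (inj₁ j) eq = cong inj₁ (x-inj eq)
    vertex-injective (inj₁ i) (inj₂ j) eq = ⊥-elim (y-part j (trans (cong part (sym eq)) (x-part i)))
    vertex-injective (inj₂ i) (inj₁ j) eq = ⊥-elim (y-part i (trans (cong part eq) (x-part j)))
    vertex-injective (inj₂ i) (inj₂ j) eq = cong inj₂ (y-inj eq)

    hom : ∀ u v → u ~′ v → vertex u ~ vertex v
    hom (inj₁ i) (inj₂ j) r = Equivalence.to (adj i j) r
    hom (inj₂ j) (inj₁ i) r = ~-sym (Equivalence.to (adj i j) r)

    hom⁻ : ∀ u v → vertex u ~ vertex v → u ~′ v
    hom⁻ (inj₁ i) (inj₁ j) e = ⊥-elim (proper e (trans (x-part i) (sym (x-part j))))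
    hom⁻ (inj₁ i) (inj₂ j) e = Equivalence.from (adj i j) e
    hom⁻ (inj₂ j) (inj₁ i) e = Equivalence.from (adj i j) (~-sym e)
    hom⁻ (inj₂ i) (inj₂ j) e = ⊥-elim (proper e (≢-≢⇒≡ (y-part i) (≢-sym (y-part j))))

-- Automorphisms from vertices, short paths, stars and pendant vertices

module Moves {ℓ : Level} (em : ExcludedMiddle ℓ) (Γ : Graph ℓ) (P : Bipartition Γ)
             (homogeneous : ConnectedHomogeneous Γ P) where

  open Graph Γ using (_~_; ~-sym; ~-irrefl)
  open Bipartition P using (part; proper)
  open Extension Γ P homogeneous public
  open Paths Γ

  _≟_ : DecidableEquality (Vertex Γ)
  u ≟ v = em

  adjacent : ∀ {a b c d} → a ~ c → b ~ d → Compatible (a , b) (c , d)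
  adjacent e e′ = ~⇒≢ e , ~⇒≢ e′ , mk⇔ (λ _ → e′) (λ _ → e)

  apart : ∀ {a b c d} → a ≢ c → b ≢ d → ¬ a ~ c → ¬ b ~ d → Compatible (a , b) (c , d)
  apart a≢c b≢d a≁c b≁d = a≢c , b≢d , mk⇔ (⊥-elim ∘ a≁c) (⊥-elim ∘ b≁d)

  move-vertex : ∀ {u v} → part u ≡ part v →
    Σ[ ψ ∈ BipartiteAutomorphism P ] Auto.to ψ u ≡ v
  move-vertex eq = let ψ , agrees = extend (base eq) in ψ , agrees (here refl)

  -- The two ends have a common neighbour, hence lie in one part and are not adjacent: every path
  -- with two edges is induced.
  move-path : ∀ {u v w u′ v′ w′} → part u ≡ part u′ →
    w ~ u → w ~ v → u ≢ v → w′ ~ u′ → w′ ~ v′ → u′ ≢ v′ →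
    Σ[ ψ ∈ BipartiteAutomorphism P ] Auto.to ψ u ≡ u′ × Auto.to ψ w ≡ w′ × Auto.to ψ v ≡ v′
  move-path eq wu wv u≢v wu′ wv′ u′≢v′ =
    let ψ , agrees = extend
          (grow (grow (base eq) (here refl) wu (λ { (here refl) → adjacent wu wu′ }))
                (here refl) (~-sym wv)
                λ { (here refl)         → adjacent (~-sym wv) (~-sym wv′)
                  ; (there (here refl)) → apart (≢-sym u≢v) (≢-sym u′≢v′)
                      (same-part⇒≁ (same-part wv wu)) (same-part⇒≁ (same-part wv′ wu′)) })
    in ψ , agrees (there (there (here refl))) , agrees (there (here refl)) , agrees (here refl)

  path-grown : ∀ {a c l} → Path a c l → Grown l
  path-grown stop         = base
  path-grown (go e a∉l p) = grow e (start∈ p) a∉l (path-grown p)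

  diagonal : ∀ {l} → Grown l → PartialIso (map (λ v → v , v) l)
  diagonal base = base refl
  diagonal (grow e c∈l a∉l g) = grow (diagonal g) (∈-map⁺ _ c∈l) e compatible
    where
    compatible : ∀ {q} → q ∈ map (λ v → v , v) _ → Compatible _ q
    compatible q∈ with ∈-map⁻ (λ v → v , v) q∈
    ... | v , v∈ , refl = (λ { refl → a∉l v∈ }) , (λ { refl → a∉l v∈ }) , mk⇔ id id

  -- The identity on a connected set, enlarged by the pair `(x , y)`, is a partial isomorphism once
  -- `x` and `y` see the set alike; the edge to `c` keeps the enlarged set connected.
  fix-and-move : ∀ {l x y c} → Grown l → x ∉ l → y ∉ l → c ∈ l → x ~ c →
    (∀ {v} → v ∈ l → x ~ v ⇔ y ~ v) →
    Σ[ ψ ∈ BipartiteAutomorphism P ] (∀ {v} → v ∈ l → Auto.to ψ v ≡ v) × Auto.to ψ x ≡ y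
  fix-and-move {l} {x} {y} g x∉l y∉l c∈l e adj =
    let ψ , agrees = extend (grow (diagonal g) (∈-map⁺ _ c∈l) e compatible)
    in ψ , (λ v∈l → agrees (there (∈-map⁺ _ v∈l))) , agrees (here refl)
    where
    compatible : ∀ {q} → q ∈ map (λ v → v , v) l → Compatible (x , y) q
    compatible q∈ with ∈-map⁻ (λ v → v , v) q∈
    ... | v , v∈ , refl = (λ { refl → x∉l v∈ }) , (λ { refl → y∉l v∈ }) , adj v∈

  star-grown : ∀ {x l} → Unique l → (∀ {n} → n ∈ l → x ~ n) → Grown (l ++ x ∷ [])
  star-grown {l = []} _ _ = base
  star-grown {x} {n ∷ l} (n∉l ∷ uniq) nbr =
    grow (~-sym (nbr (here refl))) (∈-++⁺ʳ l (here refl))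
         (λ n∈ → [ All≢⇒∉ n∉l , (λ { (here refl) → ~-irrefl (nbr (here refl)) }) ] (∈-++⁻ l n∈))
         (star-grown uniq (nbr ∘ there))

  star-iso : ∀ {x l} (g : Vertex Γ → Vertex Γ) → Injective _≡_ _≡_ g → Unique l →
             (∀ {n} → n ∈ l → x ~ n) → (∀ {n} → n ∈ l → x ~ g n) →
             PartialIso (map (λ n → n , g n) l ++ (x , x) ∷ [])
  star-iso {l = []} _ _ _ _ _ = base refl
  star-iso {x} {n ∷ l} g inj (n∉l ∷ uniq) nbr nbr′ =
    grow (star-iso g inj uniq (nbr ∘ there) (nbr′ ∘ there))
         (∈-++⁺ʳ _ (here refl)) (~-sym (nbr (here refl))) compatible
    where
    compatible : ∀ {q} → q ∈ map (λ n → n , g n) l ++ (x , x) ∷ [] → Compatible (n , g n) q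
    compatible q∈ with ∈-++⁻ (map (λ n → n , g n) l) q∈
    ... | inj₂ (here refl) = adjacent (~-sym (nbr (here refl))) (~-sym (nbr′ (here refl)))
    ... | inj₁ q∈′ with ∈-map⁻ (λ n → n , g n) q∈′
    ...   | n′ , n′∈ , refl =
      apart (All.lookup n∉l n′∈) (All.lookup n∉l n′∈ ∘ inj)
            (same-part⇒≁ (same-part (nbr (here refl)) (nbr (there n′∈))))
            (same-part⇒≁ (same-part (nbr′ (here refl)) (nbr′ (there n′∈))))

  permute-star : ∀ {x l} (g : Vertex Γ → Vertex Γ) → Injective _≡_ _≡_ g → Unique l →
             (∀ {n} → n ∈ l → x ~ n) → (∀ {n} → n ∈ l → x ~ g n) →
             Σ[ ψ ∈ BipartiteAutomorphism P ] Auto.to ψ x ≡ x × (∀ {n} → n ∈ l → Auto.to ψ n ≡ g n)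
  permute-star g inj uniq nbr nbr′ =
    let ψ , agrees = extend (star-iso g inj uniq nbr nbr′)
    in ψ , agrees (∈-++⁺ʳ _ (here refl)) , λ n∈ → agrees (∈-++⁺ˡ (∈-map⁺ _ n∈))

-- Graphs with a square

module Squares {ℓ : Level} (em : ExcludedMiddle ℓ) (Γ : Graph ℓ) (P : Bipartition Γ)
               (homogeneous : ConnectedHomogeneous Γ P)
               (connected : Connected Γ) (locally-finite : LocallyFinite Γ) where

  open Graph Γ using (_~_; ~-sym; ~-irrefl)
  open Bipartition P using (part; proper)
  open Moves em Γ P homogeneous
  open Counting _≟_

  neighbours : Vertex Γ → List (Vertex Γ)
  neighbours v = proj₁ (proj₂ (locally-finite v))

  neighbours-unique : ∀ v → Unique (neighbours v)
  neighbours-unique v = proj₁ (proj₂ (proj₂ (locally-finite v)))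

  ∈-neighbours⁻ : ∀ {v u} → u ∈ neighbours v → v ~ u
  ∈-neighbours⁻ {v} = Equivalence.to (proj₂ (proj₂ (proj₂ (proj₂ (locally-finite v)))) _)

  ∈-neighbours⁺ : ∀ {v u} → v ~ u → u ∈ neighbours v
  ∈-neighbours⁺ {v} = Equivalence.from (proj₂ (proj₂ (proj₂ (proj₂ (locally-finite v)))) _)

  -- Let K be the set of common neighbours of x₀ and x₁.  Permuting N(x₁) moves
  -- x₀ to x′ and x″ that meet N(x₁) in K − c + y and K − c − c′ + y + y′.  Some
  -- automorphism fixes x₀, x₁ and N(x₁) − c′ − y′ and moves x′ to x″; the image
  -- of c′ is then a common neighbour of x₀, x₁ and x″, so it lies in K − c − c′,
  -- but that set is fixed pointwise.
  at-most-one-missing : ∀ {x₀ x₁ c c′ y y′} →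
    x₁ ~ c → x₀ ~ c → x₁ ~ c′ → x₀ ~ c′ → c ≢ c′ →
    x₁ ~ y → ¬ x₀ ~ y → x₁ ~ y′ → ¬ x₀ ~ y′ → y ≡ y′
  at-most-one-missing {x₀} {x₁} {c} {c′} {y} {y′} x₁c x₀c x₁c′ x₀c′ c≢c′ x₁y x₀≁y x₁y′ x₀≁y′ =
    decidable-stable (y ≟ y′) contra
    where
    module _ (y≢y′ : y ≢ y′) where
      τ τ′ : Vertex Γ → Vertex Γ
      τ  = transpose c y
      τ′ = transpose c′ y′

      c≢y′ : c ≢ y′
      c≢y′ refl = x₀≁y′ x₀c
      c′≢y : c′ ≢ y
      c′≢y refl = x₀≁y x₀c′

      τ-nbr : ∀ {a b n} → x₁ ~ a → x₁ ~ b → x₁ ~ n → x₁ ~ transpose a b n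
      τ-nbr {a} {b} {n} ea eb en with n ≟ a | n ≟ b
      ... | yes _ | _     = eb
      ... | no _  | yes _ = ea
      ... | no _  | no _  = en

      τ-injective : ∀ a b → Injective _≡_ _≡_ (transpose a b)
      τ-injective a b eq =
        trans (sym (transpose-involutive a b _))
              (trans (cong (transpose a b) eq) (transpose-involutive a b _))

      -- Here `h` is the inverse of `g`. An automorphism that fixes `x₁` and acts on its neighbours
      -- as `g` takes `x₀` to the vertex sought: its trace on the neighbours of `x₁` is the
      -- `g`-image of the trace of `x₀`.
      permuted : (g h : Vertex Γ → Vertex Γ) → Injective _≡_ _≡_ g → (∀ n → g (h n) ≡ n) →
        (∀ {n} → x₁ ~ n → x₁ ~ g n) → (∀ {n} → x₁ ~ n → x₁ ~ h n) →
        ∃[ x ] part x ≡ part x₀ × (∀ {n} → x₁ ~ n → x ~ n ⇔ x₀ ~ h n)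
      permuted g h inj gh g-nbr h-nbr
        with permute-star g inj (neighbours-unique x₁) ∈-neighbours⁻ (g-nbr ∘ ∈-neighbours⁻)
      ... | ψ , _ , agrees = ψ.to x₀ , ψ.preserves x₀ , λ {n} e →
        let eq = trans (agrees (∈-neighbours⁺ (h-nbr e))) (gh n) in
        mk⇔ (λ e′ → ψ.to-~⁻ (subst (ψ.to x₀ ~_) (sym eq) e′))
            (λ e′ → subst (ψ.to x₀ ~_) eq (ψ.to-~ e′))
        where module ψ = Auto ψ

      first : ∃[ x ] part x ≡ part x₀ × (∀ {n} → x₁ ~ n → x ~ n ⇔ x₀ ~ τ n)
      first = permuted τ τ (τ-injective c y) (transpose-involutive c y) (τ-nbr x₁c x₁y) (τ-nbr x₁c x₁y)

      second : ∃[ x ] part x ≡ part x₀ × (∀ {n} → x₁ ~ n → x ~ n ⇔ x₀ ~ τ′ (τ n))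
      second = permuted (τ ∘ τ′) (τ′ ∘ τ) (λ eq → τ-injective c′ y′ (τ-injective c y eq))
        (λ n → trans (cong τ (transpose-involutive c′ y′ (τ n))) (transpose-involutive c y n))
        (τ-nbr x₁c x₁y ∘ τ-nbr x₁c′ x₁y′) (τ-nbr x₁c′ x₁y′ ∘ τ-nbr x₁c x₁y)

      x′ x″ : Vertex Γ
      x′ = proj₁ first
      x″ = proj₁ second

      x′~ : ∀ {n} → x₁ ~ n → x′ ~ n ⇔ x₀ ~ τ n
      x′~ = proj₂ (proj₂ first)

      x″~ : ∀ {n} → x₁ ~ n → x″ ~ n ⇔ x₀ ~ τ′ (τ n)
      x″~ = proj₂ (proj₂ second)

      -- If `n` avoids `c′` and `y′`, then so does `τ n`, and `τ′` does not move it. Hence `x′` and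
      -- `x″` have the same neighbours in `L`.
      τ′τ-fixed : ∀ {n} → n ≢ c′ → n ≢ y′ → τ′ (τ n) ≡ τ n
      τ′τ-fixed {n} n≢c′ n≢y′ with n ≟ c | n ≟ y
      ... | yes _ | _     = transpose-other c′ y′ (≢-sym c′≢y) y≢y′
      ... | no _  | yes _ = transpose-other c′ y′ c≢c′ c≢y′
      ... | no _  | no _  = transpose-other c′ y′ n≢c′ n≢y′

      x′≁c : ¬ x′ ~ c
      x′≁c e = x₀≁y (subst (x₀ ~_) (transpose-left c y) (Equivalence.to (x′~ x₁c) e))

      x″≁c : ¬ x″ ~ c
      x″≁c e = x₀≁y (subst (x₀ ~_)
        (trans (τ′τ-fixed c≢c′ c≢y′) (transpose-left c y)) (Equivalence.to (x″~ x₁c) e))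

      x₀-part : part x₀ ≡ part x₁
      x₀-part = same-part (~-sym x₀c) (~-sym x₁c)

      L fixed : List (Vertex Γ)
      L     = neighbours x₁ without c′ without y′
      fixed = x₀ ∷ L ++ x₁ ∷ []

      ∈-L⁻ : ∀ {n} → n ∈ L → x₁ ~ n × n ≢ c′ × n ≢ y′
      ∈-L⁻ n∈ = let n∈′ , n≢y′ = ∈-without⁻ n∈ ; n∈″ , n≢c′ = ∈-without⁻ n∈′
                in ∈-neighbours⁻ n∈″ , n≢c′ , n≢y′

      ∈-L⁺ : ∀ {n} → x₁ ~ n → n ≢ c′ → n ≢ y′ → n ∈ L
      ∈-L⁺ e n≢c′ n≢y′ = ∈-without⁺ (∈-without⁺ (∈-neighbours⁺ e) n≢c′) n≢y′

      opposite∉ : ∀ {x} → part x ≡ part x₀ → x ≢ x₁ → x ∉ L ++ x₁ ∷ []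
      opposite∉ eq x≢x₁ x∈ with ∈-++⁻ L x∈
      ... | inj₂ (here refl) = x≢x₁ refl
      ... | inj₁ x∈L = proper (proj₁ (∈-L⁻ x∈L)) (trans (sym x₀-part) (sym eq))

      fixed-grown : Grown fixed
      fixed-grown = grow x₀c (∈-++⁺ˡ (∈-L⁺ x₁c c≢c′ c≢y′))
        (opposite∉ refl λ { refl → x₀≁y x₁y })
        (star-grown (without-unique (without-unique (neighbours-unique x₁))) (proj₁ ∘ ∈-L⁻))

      outside : ∀ {x} → part x ≡ part x₀ → ¬ x ~ c → x ∉ fixed
      outside eq x≁c (here refl) = x≁c x₀c
      outside eq x≁c (there x∈)  = opposite∉ eq (λ { refl → x≁c x₁c }) x∈

      same-adjacency : ∀ {v} → v ∈ fixed → x′ ~ v ⇔ x″ ~ v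
      same-adjacency (here refl) =
        mk⇔ (⊥-elim ∘ same-part⇒≁ (proj₁ (proj₂ first))) (⊥-elim ∘ same-part⇒≁ (proj₁ (proj₂ second)))
      same-adjacency (there v∈) with ∈-++⁻ L v∈
      ... | inj₂ (here refl) =
        mk⇔ (⊥-elim ∘ same-part⇒≁ (trans (proj₁ (proj₂ first)) x₀-part))
            (⊥-elim ∘ same-part⇒≁ (trans (proj₁ (proj₂ second)) x₀-part))
      ... | inj₁ v∈L with ∈-L⁻ v∈L
      ...   | e , v≢c′ , v≢y′ =
        mk⇔ (λ e′ → Equivalence.from (x″~ e) (subst (x₀ ~_) (sym (τ′τ-fixed v≢c′ v≢y′)) (Equivalence.to (x′~ e) e′)))
            (λ e′ → Equivalence.from (x′~ e) (subst (x₀ ~_) (τ′τ-fixed v≢c′ v≢y′) (Equivalence.to (x″~ e) e′)))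

      contradict : Σ[ ψ ∈ BipartiteAutomorphism P ] (∀ {v} → v ∈ fixed → Auto.to ψ v ≡ v) × Auto.to ψ x′ ≡ x″ → ⊥
      contradict (ψ , fixes , x′↦x″) = case-c′ (ψ.to c′ ≟ c′) (ψ.to c′ ≟ y′)
        where
        module ψ = Auto ψ
        x₁~ψc′ : x₁ ~ ψ.to c′
        x₁~ψc′ = subst (_~ ψ.to c′) (fixes (there (∈-++⁺ʳ L (here refl)))) (ψ.to-~ x₁c′)
        x₀~ψc′ : x₀ ~ ψ.to c′
        x₀~ψc′ = subst (_~ ψ.to c′) (fixes (here refl)) (ψ.to-~ x₀c′)
        τc′ : τ c′ ≡ c′
        τc′ = transpose-other c y (≢-sym c≢c′) c′≢y
        x″~ψc′ : x″ ~ ψ.to c′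
        x″~ψc′ = subst (_~ ψ.to c′) x′↦x″
          (ψ.to-~ (Equivalence.from (x′~ x₁c′) (subst (x₀ ~_) (sym τc′) x₀c′)))
        case-c′ : Dec (ψ.to c′ ≡ c′) → Dec (ψ.to c′ ≡ y′) → ⊥
        case-c′ (yes eq) _ = x₀≁y′ (subst (x₀ ~_)
          (trans (cong τ′ τc′) (transpose-left c′ y′))
          (Equivalence.to (x″~ x₁c′) (subst (x″ ~_) eq x″~ψc′)))
        case-c′ (no _) (yes eq) = x₀≁y′ (subst (x₀ ~_) eq x₀~ψc′)
        case-c′ (no ≢c′) (no ≢y′) =
          ≢c′ (ψ.to-injective (fixes (there (∈-++⁺ˡ (∈-L⁺ x₁~ψc′ ≢c′ ≢y′)))))

      contra : ⊥
      contra = contradict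
        (fix-and-move fixed-grown
          (outside (proj₁ (proj₂ first)) x′≁c) (outside (proj₁ (proj₂ second)) x″≁c)
          -- The vertex `y` links `x′` to the fixed set: `τ y` is `c`, a neighbour of `x₀`.
          (there (∈-++⁺ˡ (∈-L⁺ x₁y (≢-sym c′≢y) y≢y′)))
          (Equivalence.from (x′~ x₁y) (subst (x₀ ~_) (sym (transpose-right c y)) x₀c))
          same-adjacency)

-- Complete bipartite graphs and complements of perfect matchings

module Classification {ℓ : Level} (em : ExcludedMiddle ℓ) (Γ : Graph ℓ) (P : Bipartition Γ)
                      (homogeneous : ConnectedHomogeneous Γ P)
                      (connected : Connected Γ) (locally-finite : LocallyFinite Γ) where

  open Graph Γ using (_~_; ~-sym; ~-irrefl)
  open Bipartition P using (part; proper)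
  open Moves em Γ P homogeneous public
  open Squares em Γ P homogeneous connected locally-finite public
  open Paths Γ

  ThreeWalksClose : Set ℓ
  ThreeWalksClose = ∀ {a b c d} → a ~ b → b ~ c → c ~ d → a ~ d

  -- Along a walk from `x₀` the vertices are adjacent alternately to `y₀` and to `x₀`, so the two
  -- neighbourhoods exhaust the graph.
  three-walks-close⇒complete : ∀ {x₀ y₀} → x₀ ~ y₀ → ThreeWalksClose →
    Σ[ m ∈ ℕ ] Σ[ n ∈ ℕ ] (Γ ≅ CompleteBipartite m n)
  three-walks-close⇒complete {x₀} {y₀} x₀y₀ close =
    length (neighbours y₀) , length (neighbours x₀) ,
    bipartite-coordinates P (lookup (neighbours y₀)) (lookup (neighbours x₀))
      (lookup-injective (neighbours-unique y₀)) (lookup-injective (neighbours-unique x₀))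
      (λ i → same-part (xs i) (~-sym x₀y₀))
      (λ j eq → proper (ys j) (sym eq))
      (λ v → cover (reach (connected x₀ v) (inj₁ (~-sym x₀y₀))))
      (λ i j → mk⇔ (λ _ → close (~-sym (xs i)) (~-sym x₀y₀) (ys j)) (λ _ → tt))
    where
    xs : ∀ i → y₀ ~ lookup (neighbours y₀) i
    xs i = ∈-neighbours⁻ (∈-lookup i)
    ys : ∀ j → x₀ ~ lookup (neighbours x₀) j
    ys j = ∈-neighbours⁻ (∈-lookup j)
    reach : ∀ {u v} → Star _~_ u v → y₀ ~ u ⊎ x₀ ~ u → y₀ ~ v ⊎ x₀ ~ v
    reach ε        r         = r
    reach (e ◅ es) (inj₁ yu) = reach es (inj₂ (close x₀y₀ yu e))
    reach (e ◅ es) (inj₂ xu) = reach es (inj₁ (close (~-sym x₀y₀) xu e))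
    cover : ∀ {v} → y₀ ~ v ⊎ x₀ ~ v →
            (∃[ i ] lookup (neighbours y₀) i ≡ v) ⊎ (∃[ j ] lookup (neighbours x₀) j ≡ v)
    cover (inj₁ e) = inj₁ (_ , sym (lookup-index (∈-neighbours⁺ e)))
    cover (inj₂ e) = inj₂ (_ , sym (lookup-index (∈-neighbours⁺ e)))

  isolated⇒complete : ∀ v → (∀ u → ¬ v ~ u) → Σ[ m ∈ ℕ ] Σ[ n ∈ ℕ ] (Γ ≅ CompleteBipartite m n)
  isolated⇒complete v isolated = 1 , 0 ,
    bipartite-coordinates P (λ _ → v) (λ ()) (λ { {zero} {zero} _ → refl }) (λ { {()} })
      (λ _ → refl) (λ ()) (λ u → inj₁ (zero , only (connected v u))) (λ _ ())
    where
    only : ∀ {u} → Star _~_ v u → v ≡ u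
    only ε       = refl
    only (e ◅ _) = ⊥-elim (isolated _ e)

  -- `Connected` holds vacuously of the graph without vertices, which therefore has to appear in the
  -- list: it is K_{0,0}.
  empty⇒complete : ¬ Vertex Γ → Σ[ m ∈ ℕ ] Σ[ n ∈ ℕ ] (Γ ≅ CompleteBipartite m n)
  empty⇒complete empty = 0 , 0 ,
    bipartite-coordinates P {p = X} (λ ()) (λ ()) (λ { {()} }) (λ { {()} })
      (λ ()) (λ ()) (⊥-elim ∘ empty) (λ ())

  record InducedPath₄ : Set ℓ where
    field
      {a b c d} : Vertex Γ
      ab : a ~ b
      bc : b ~ c
      cd : c ~ d
      a≁d : ¬ a ~ d

    a≢c : a ≢ c
    a≢c a≡c = a≁d (subst (_~ d) (sym a≡c) cd)
    b≢d : b ≢ d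
    b≢d b≡d = a≁d (subst (a ~_) b≡d ab)

  three-walks-close? : InducedPath₄ ⊎ ThreeWalksClose
  three-walks-close? with em {InducedPath₄}
  ... | yes p = inj₁ p
  ... | no ¬p = inj₂ λ ab bc cd → decidable-stable em λ a≁d →
    ¬p (record { ab = ab ; bc = bc ; cd = cd ; a≁d = a≁d })

  -- Having two neighbours, phrased as avoidance: whichever vertex is excluded, a neighbour remains.
  -- This is what continues a path without turning back.
  TwoNeighbours : Vertex Γ → Set ℓ
  TwoNeighbours v = ∀ a → ∃[ w ] v ~ w × w ≢ a

  two-neighbours : ∀ {v a b} → v ~ a → v ~ b → a ≢ b → TwoNeighbours v
  two-neighbours {a = a} {b} va vb a≢b z with a ≟ z
  ... | yes refl = b , vb , ≢-sym a≢b
  ... | no a≢z   = a , va , a≢z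

  two-neighbours-transport : ∀ {u v} → part u ≡ part v → TwoNeighbours u → TwoNeighbours v
  two-neighbours-transport eq two a with move-vertex eq
  ... | ψ , refl with two (Auto.from ψ a)
  ...   | w , uw , w≢ = Auto.to ψ w , Auto.to-~ ψ uw ,
                        λ ψw≡a → w≢ (trans (sym (Auto.from∘to ψ w)) (cong (Auto.from ψ) ψw≡a))

  -- Reduces a claim about all vertices to the two ends of one edge, since automorphisms are
  -- transitive on each part.
  part-cover : ∀ {u v} → u ~ v → ∀ w → part u ≡ part w ⊎ part v ≡ part w
  part-cover {u} {v} e w with part u ≟ᴾ part w
  ... | yes eq = inj₁ eq
  ... | no ne  = inj₂ (≢-≢⇒≡ (≢-sym (proper e)) ne)

  induced-path⇒two-neighbours : InducedPath₄ → ∀ v → TwoNeighbours v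
  induced-path⇒two-neighbours p v with part-cover (InducedPath₄.bc p) v
  ... | inj₁ eq = two-neighbours-transport eq (two-neighbours (~-sym ab) bc a≢c)
    where open InducedPath₄ p
  ... | inj₂ eq = two-neighbours-transport eq (two-neighbours (~-sym bc) cd b≢d)
    where open InducedPath₄ p

  record Square : Set ℓ where
    field
      {p q r s} : Vertex Γ
      pq : p ~ q
      qr : q ~ r
      rs : r ~ s
      sp : s ~ p
      p≢r : p ≢ r
      q≢s : q ≢ s

  module WithSquare (path : InducedPath₄) (square : Square) where

    open InducedPath₄ path
    open Square square hiding (p)

    -- The square contains the paths `p q r` and `q r s`, one for each part of the end vertices, and
    -- the fourth vertex is a second common neighbour of the ends. `move-path` carries this to
    -- `u w v`.
    another-common-neighbour : ∀ {u v w} → w ~ u → w ~ v → u ≢ v → ∃[ w′ ] w′ ≢ w × w′ ~ u × w′ ~ v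
    another-common-neighbour {u} {v} {w} wu wv u≢v with part-cover pq u
    ... | inj₁ eq with move-path eq (~-sym pq) qr p≢r wu wv u≢v
    ...   | ψ , refl , refl , refl = Auto.to ψ s , ≢-sym q≢s ∘ Auto.to-injective ψ ,
                                     Auto.to-~ ψ sp , Auto.to-~ ψ (~-sym rs)
    another-common-neighbour {u} {v} {w} wu wv u≢v | inj₂ eq
      with move-path eq (~-sym qr) rs q≢s wu wv u≢v
    ... | ψ , refl , refl , refl = Auto.to ψ (Square.p square) , p≢r ∘ Auto.to-injective ψ ,
                                   Auto.to-~ ψ pq , Auto.to-~ ψ (~-sym sp)

    Misses : Vertex Γ → Vertex Γ → Vertex Γ → Set ℓ
    Misses u v z = u ~ z × ¬ v ~ z

    -- In the induced path, `a` is adjacent to `b` but not to `d`, and `d` is adjacent to `c` but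
    -- not to `a`; this settles one path with two edges for each part.
    misses : ∀ {u v w} → w ~ u → w ~ v → u ≢ v → ∃ (Misses u v)
    misses {u} wu wv u≢v with part-cover bc u
    ... | inj₁ eq with move-path eq (~-sym bc) cd b≢d wu wv u≢v
    ...   | ψ , refl , refl , refl = Auto.to ψ a , Auto.to-~ ψ (~-sym ab) , a≁d ∘ ~-sym ∘ Auto.to-~⁻ ψ
    misses {u} wu wv u≢v | inj₂ eq with move-path eq bc (~-sym ab) (≢-sym a≢c) wu wv u≢v
    ... | ψ , refl , refl , refl = Auto.to ψ d , Auto.to-~ ψ cd , a≁d ∘ Auto.to-~⁻ ψ

    misses-unique : ∀ {u v w z z′} → w ~ u → w ~ v → Misses u v z → Misses u v z′ → z ≡ z′
    misses-unique {u} {v} wu wv (uz , v≁z) (uz′ , v≁z′) with u ≟ v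
    ... | yes refl = ⊥-elim (v≁z uz)
    ... | no u≢v with another-common-neighbour wu wv u≢v
    ...   | w′ , w′≢w , w′u , w′v =
      at-most-one-missing (~-sym wu) (~-sym wv) (~-sym w′u) (~-sym w′v) (≢-sym w′≢w) uz v≁z uz′ v≁z′

    Common : Vertex Γ → Vertex Γ → Set ℓ
    Common u v = ∃[ w ] w ~ u × w ~ v

    -- The vertices `u` and `v` have two common neighbours, and `w` misses at most one neighbour of
    -- `v`, so one of the two is adjacent to `w`.
    common-trans : ∀ {u v w} → u ≢ v → Common u v → Common v w → Common u w
    common-trans {u} {v} {w} u≢v (x , xu , xv) (y , yv , yw)
      with another-common-neighbour xu xv u≢v
    ... | x′ , x′≢x , x′u , x′v with em {w ~ x} | em {w ~ x′}
    ...   | yes wx | _       = x , xu , ~-sym wx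
    ...   | no _   | yes wx′ = x′ , x′u , ~-sym wx′
    ...   | no w≁x | no w≁x′ =
      ⊥-elim (x′≢x (misses-unique yv yw (~-sym x′v , w≁x′) (~-sym xv , w≁x)))

    private
      Near : Vertex Γ → Vertex Γ → Set ℓ
      Near u v = u ≡ v ⊎ Common u v

      Reached : Vertex Γ → Vertex Γ → Set ℓ
      Reached u v = Near u v ⊎ (∃[ v′ ] v′ ~ v × part u ≡ part v′ × Near u v′)

      near-part : ∀ {u v} → Near u v → part u ≡ part v
      near-part (inj₁ refl)          = refl
      near-part (inj₂ (_ , wu , wv)) = same-part wu wv

      reached : ∀ {u v w} → Star _~_ v w → Reached u v → Reached u w
      reached ε r = r
      reached (e ◅ es) (inj₁ near) = reached es (inj₂ (_ , e , near-part near , near))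
      reached {u} {v} (_◅_ {j = w} e es) (inj₂ (v′ , v′v , _ , inj₁ refl)) =
        reached es (inj₁ (inj₂ (v , ~-sym v′v , e)))
      reached {u} {v} (_◅_ {j = w} e es) (inj₂ (v′ , v′v , _ , inj₂ common)) with u ≟ v′
      ... | yes refl = reached es (inj₁ (inj₂ (v , ~-sym v′v , e)))
      ... | no u≢v′  = reached es (inj₁ (inj₂ (common-trans u≢v′ common (v , ~-sym v′v , e))))

    -- By `common-trans`, the vertices of a walk from `u` stay at distance at most three from `u`,
    -- and those in the part of `u` at distance at most two.
    same-part⇒common : ∀ {u v} → part u ≡ part v → u ≢ v → Common u v
    same-part⇒common {u} {v} eq u≢v with reached (connected u v) (inj₁ (inj₁ refl))
    ... | inj₁ (inj₁ u≡v)          = ⊥-elim (u≢v u≡v)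
    ... | inj₁ (inj₂ common)       = common
    ... | inj₂ (_ , v′v , eq′ , _) = ⊥-elim (proper v′v (trans (sym eq′) eq))

    two : ∀ v → TwoNeighbours v
    two = induced-path⇒two-neighbours path

    abstract
      non-neighbour : ∀ v → ∃[ z ] part z ≢ part v × ¬ v ~ z
      non-neighbour v with two v v
      ... | w , vw , _ with two w v
      ...   | v′ , wv′ , v′≢v with misses wv′ (~-sym vw) v′≢v
      ...     | z , v′z , v≁z = z , (λ eq → proper v′z (trans (same-part wv′ (~-sym vw)) (sym eq))) , v≁z

    -- If v had distinct non-neighbours z and z′, then neighbours x₀ of z and x₂ of
    -- z′ would miss the same neighbour u of v.  But among the neighbours of a
    -- common neighbour w of v and x₀, only one misses u.
    non-neighbour-unique : ∀ {v z z′} → part z ≢ part v → ¬ v ~ z → part z′ ≢ part v → ¬ v ~ z′ → z ≡ z′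
    non-neighbour-unique {v} {z} {z′} z-part v≁z z′-part v≁z′ = decidable-stable (z ≟ z′) contra
      where
      module _ (z≢z′ : z ≢ z′) where
        x₀ x₂ : Vertex Γ
        x₀ = proj₁ (two z z)
        x₂ = proj₁ (two z′ z′)
        zx₀ : z ~ x₀
        zx₀ = proj₁ (proj₂ (two z z))
        z′x₂ : z′ ~ x₂
        z′x₂ = proj₁ (proj₂ (two z′ z′))
        x₀≢v : x₀ ≢ v
        x₀≢v eq = v≁z (subst (_~ z) eq (~-sym zx₀))
        x₂≢v : x₂ ≢ v
        x₂≢v eq = v≁z′ (subst (_~ z′) eq (~-sym z′x₂))
        c₀ : Common x₀ v
        c₀ = same-part⇒common (≢-≢⇒≡ (≢-sym (proper zx₀)) z-part) x₀≢v
        c₂ : Common x₂ v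
        c₂ = same-part⇒common (≢-≢⇒≡ (≢-sym (proper z′x₂)) z′-part) x₂≢v
        x₂≁z : ¬ x₂ ~ z
        x₂≁z e = z≢z′ (misses-unique (proj₁ (proj₂ c₂)) (proj₂ (proj₂ c₂)) (e , v≁z) (~-sym z′x₂ , v≁z′))
        x₀≢x₂ : x₀ ≢ x₂
        x₀≢x₂ eq = x₂≁z (subst (_~ z) eq (~-sym zx₀))
        c₀₂ : Common x₀ x₂
        c₀₂ = same-part⇒common (trans (same-part (proj₁ (proj₂ c₀)) (proj₂ (proj₂ c₀)))
                                      (same-part (proj₂ (proj₂ c₂)) (proj₁ (proj₂ c₂)))) x₀≢x₂
        m₀ : ∃ (Misses v x₀)
        m₀ = misses (proj₂ (proj₂ c₀)) (proj₁ (proj₂ c₀)) (≢-sym x₀≢v)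
        m₂ : ∃ (Misses v x₂)
        m₂ = misses (proj₂ (proj₂ c₂)) (proj₁ (proj₂ c₂)) (≢-sym x₂≢v)
        u : Vertex Γ
        u = proj₁ m₀
        vu : v ~ u
        vu = proj₁ (proj₂ m₀)
        x₀≁u : ¬ x₀ ~ u
        x₀≁u = proj₂ (proj₂ m₀)
        -- Let `u₂` be the neighbour of `v` missed by `x₂`. If `x₀` misses it too, it equals `u` by
        -- uniqueness for `v` and `x₀`. Otherwise `u₂` and `z` are both neighbours of `x₀` missed by
        -- `x₂`, hence equal, although `v` misses `z`.
        x₂≁u : ¬ x₂ ~ u
        x₂≁u x₂u with em {x₀ ~ proj₁ m₂}
        ... | no x₀≁u₂ = proj₂ (proj₂ m₂) (subst (x₂ ~_)
          (misses-unique (proj₂ (proj₂ c₀)) (proj₁ (proj₂ c₀)) (vu , x₀≁u) (proj₁ (proj₂ m₂) , x₀≁u₂)) x₂u)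
        ... | yes x₀u₂ = v≁z (subst (v ~_)
          (misses-unique (proj₁ (proj₂ c₀₂)) (proj₂ (proj₂ c₀₂)) (x₀u₂ , proj₂ (proj₂ m₂)) (~-sym zx₀ , x₂≁z))
          (proj₁ (proj₂ m₂)))
        w : Vertex Γ
        w = proj₁ c₀
        w≢u : w ≢ u
        w≢u eq = x₀≁u (~-sym (subst (_~ x₀) eq (proj₁ (proj₂ c₀))))
        wx₂ : w ~ x₂
        wx₂ = decidable-stable em λ w≁x₂ → w≢u
          (misses-unique (proj₂ (proj₂ c₂)) (proj₁ (proj₂ c₂))
            (~-sym (proj₂ (proj₂ c₀)) , w≁x₂ ∘ ~-sym) (vu , x₂≁u))
        contra : ⊥
        contra = x₀≢x₂ (misses-unique (~-sym (proj₂ (proj₂ c₀))) vu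
          (proj₁ (proj₂ c₀) , x₀≁u ∘ ~-sym) (wx₂ , x₂≁u ∘ ~-sym))

    partner : Vertex Γ → Vertex Γ
    partner v = proj₁ (non-neighbour v)

    partner-part : ∀ v → part (partner v) ≢ part v
    partner-part v = proj₁ (proj₂ (non-neighbour v))

    partner-≁ : ∀ v → ¬ v ~ partner v
    partner-≁ v = proj₂ (proj₂ (non-neighbour v))

    partner-involutive : ∀ v → partner (partner v) ≡ v
    partner-involutive v = non-neighbour-unique
      (partner-part (partner v)) (partner-≁ (partner v))
      (≢-sym (partner-part v)) (partner-≁ v ∘ ~-sym)

    partner-injective : Injective _≡_ _≡_ partner
    partner-injective {u} {v} eq =
      trans (sym (partner-involutive u)) (trans (cong partner eq) (partner-involutive v))

    adjacent⇔ : ∀ {u v} → part v ≢ part u → (v ≢ partner u) ⇔ u ~ v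
    adjacent⇔ {u} v-part = mk⇔
      (λ v≢ → decidable-stable em λ u≁v → v≢ (non-neighbour-unique v-part u≁v (partner-part u) (partner-≁ u)))
      (λ { e refl → partner-≁ u e })

    -- The part opposite to `y₀` consists of the neighbours of `y₀` and its single non-neighbour, so
    -- it is finite. Enumerating the other part through `partner` turns the matching into the
    -- identity permutation.
    complement-of-perfect-matching :
      Σ[ n ∈ ℕ ] Σ[ η ∈ Permutation′ n ] (Γ ≅ ComplementOfPerfectMatching n η)
    complement-of-perfect-matching = length xs , Perm.id ,
      bipartite-coordinates P {p = part x₀} (lookup xs) (partner ∘ lookup xs)
        xs-injective (λ eq → xs-injective (partner-injective eq))
        x-part
        (λ j eq → partner-part (lookup xs j) (trans eq (sym (x-part j))))
        cover
        (λ i j → mk⇔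
          (λ j≢i → Equivalence.to (adjacent⇔ (part-≢ i j)) (λ eq → j≢i (xs-injective (partner-injective eq))))
          (λ e j≡i → Equivalence.from (adjacent⇔ (part-≢ i j)) e (cong (partner ∘ lookup xs) j≡i)))
      where
      y₀ x₀ : Vertex Γ
      y₀ = a
      x₀ = partner y₀
      xs : List (Vertex Γ)
      xs = x₀ ∷ neighbours y₀
      xs-unique : Unique xs
      xs-unique = ∉⇒All≢ (partner-≁ y₀ ∘ ∈-neighbours⁻) ∷ neighbours-unique y₀
      xs-injective : Injective _≡_ _≡_ (lookup xs)
      xs-injective = lookup-injective xs-unique
      ∈-xs : ∀ {v} → part v ≢ part y₀ → v ∈ xs
      ∈-xs {v} v-part with v ≟ x₀
      ... | yes v≡x₀ = here v≡x₀
      ... | no v≢x₀  = there (∈-neighbours⁺ (Equivalence.to (adjacent⇔ v-part) v≢x₀))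
      x-part : ∀ i → part (lookup xs i) ≡ part x₀
      x-part zero    = refl
      x-part (suc i) = ≢-≢⇒≡ (≢-sym (proper (∈-neighbours⁻ (∈-lookup {xs = neighbours y₀} i))))
                             (≢-sym (partner-part y₀))
      part-≢ : ∀ i j → part (partner (lookup xs j)) ≢ part (lookup xs i)
      part-≢ i j eq = partner-part (lookup xs j) (trans eq (trans (x-part i) (sym (x-part j))))
      cover : ∀ v → (∃[ i ] lookup xs i ≡ v) ⊎ (∃[ j ] partner (lookup xs j) ≡ v)
      cover v with part v ≟ᴾ part y₀
      ... | no v-part  = inj₁ (index (∈-xs v-part) , sym (lookup-index (∈-xs v-part)))
      ... | yes v-part = inj₂ (index v∈ , trans (cong partner (sym (lookup-index v∈))) (partner-involutive v))
        where
        v∈ : partner v ∈ xs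
        v∈ = ∈-xs λ eq → partner-part v (trans eq (sym v-part))

-- Graphs without a square

module WithoutSquare {ℓ : Level} (em : ExcludedMiddle ℓ) (Γ : Graph ℓ) (P : Bipartition Γ)
                     (homogeneous : ConnectedHomogeneous Γ P)
                     (connected : Connected Γ) (locally-finite : LocallyFinite Γ) where

  open Graph Γ using (_~_; ~-sym; ~-irrefl)
  open Bipartition P using (part; proper)
  open Classification em Γ P homogeneous connected locally-finite
  open Paths Γ

  ThreeNeighbours : Vertex Γ → Set ℓ
  ThreeNeighbours v = ∀ a b → ∃[ w ] v ~ w × w ≢ a × w ≢ b

  three-neighbours : ∀ {v a b c} → v ~ a → v ~ b → v ~ c → a ≢ b → a ≢ c → b ≢ c → ThreeNeighbours v
  three-neighbours {v} {a} {b} {c} va vb vc a≢b a≢c b≢c z z′ = choose (test a) (test b) (test c)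
    where
    test : ∀ x → (x ≢ z × x ≢ z′) ⊎ (x ≡ z ⊎ x ≡ z′)
    test x with x ≟ z | x ≟ z′
    ... | yes x≡z | _        = inj₂ (inj₁ x≡z)
    ... | no _    | yes x≡z′ = inj₂ (inj₂ x≡z′)
    ... | no x≢z  | no x≢z′  = inj₁ (x≢z , x≢z′)
    choose : (a ≢ z × a ≢ z′) ⊎ (a ≡ z ⊎ a ≡ z′) → (b ≢ z × b ≢ z′) ⊎ (b ≡ z ⊎ b ≡ z′) →
             (c ≢ z × c ≢ z′) ⊎ (c ≡ z ⊎ c ≡ z′) → ∃[ w ] v ~ w × w ≢ z × w ≢ z′
    choose (inj₁ ok) _ _ = a , va , ok
    choose _ (inj₁ ok) _ = b , vb , ok
    choose _ _ (inj₁ ok) = c , vc , ok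
    choose (inj₂ (inj₁ refl)) (inj₂ (inj₁ refl)) _ = ⊥-elim (a≢b refl)
    choose (inj₂ (inj₂ refl)) (inj₂ (inj₂ refl)) _ = ⊥-elim (a≢b refl)
    choose (inj₂ (inj₁ refl)) (inj₂ (inj₂ _)) (inj₂ (inj₁ refl)) = ⊥-elim (a≢c refl)
    choose (inj₂ (inj₁ _)) (inj₂ (inj₂ refl)) (inj₂ (inj₂ refl)) = ⊥-elim (b≢c refl)
    choose (inj₂ (inj₂ _)) (inj₂ (inj₁ refl)) (inj₂ (inj₁ refl)) = ⊥-elim (b≢c refl)
    choose (inj₂ (inj₂ refl)) (inj₂ (inj₁ _)) (inj₂ (inj₂ refl)) = ⊥-elim (a≢c refl)

  three-neighbours-transport : ∀ {u v} → part u ≡ part v → ThreeNeighbours u → ThreeNeighbours v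
  three-neighbours-transport eq three a b with move-vertex eq
  ... | ψ , refl with three (Auto.from ψ a) (Auto.from ψ b)
  ...   | w , uw , w≢a , w≢b = Auto.to ψ w , Auto.to-~ ψ uw ,
          (λ { refl → w≢a (sym (Auto.from∘to ψ w)) }) , (λ { refl → w≢b (sym (Auto.from∘to ψ w)) })

  two-apart : ∀ {a b c} → b ~ a → b ~ c → ¬ a ~ c
  two-apart ba bc = same-part⇒≁ (same-part ba bc)

  three-apart : ∀ {a b c d} → a ~ b → b ~ c → c ~ d → a ≢ d
  three-apart ab bc cd refl = two-apart (~-sym ab) bc (~-sym cd)

  move-leaf : ∀ {l x y c} → Grown l → c ∈ l → x ~ c → y ~ c →
    (∀ {v} → v ∈ l → v ≢ c → x ≢ v × y ≢ v × ¬ x ~ v × ¬ y ~ v) →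
    Σ[ ψ ∈ BipartiteAutomorphism P ] (∀ {v} → v ∈ l → Auto.to ψ v ≡ v) × Auto.to ψ x ≡ y
  move-leaf {l} {x} {y} {c} g c∈l xc yc others = fix-and-move g
    (λ x∈l → proj₁ (others x∈l (~⇒≢ xc)) refl)
    (λ y∈l → proj₁ (proj₂ (others y∈l (~⇒≢ yc))) refl)
    c∈l xc adj
    where
    adj : ∀ {v} → v ∈ l → x ~ v ⇔ y ~ v
    adj {v} v∈l with v ≟ c
    ... | yes refl = mk⇔ (λ _ → yc) (λ _ → xc)
    ... | no v≢c with others v∈l v≢c
    ...   | _ , _ , x≁v , y≁v = mk⇔ (⊥-elim ∘ x≁v) (⊥-elim ∘ y≁v)

  -- Distinctness is recorded within each part; across the parts it follows from parity, and the
  -- absence of squares excludes chords.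
  record Hexagon : Set ℓ where
    field
      {v₀ v₁ v₂ v₃ v₄ v₅} : Vertex Γ
      e₀₁ : v₀ ~ v₁
      e₁₂ : v₁ ~ v₂
      e₂₃ : v₂ ~ v₃
      e₃₄ : v₃ ~ v₄
      e₄₅ : v₄ ~ v₅
      e₅₀ : v₅ ~ v₀
      d₀₂ : v₀ ≢ v₂
      d₂₄ : v₂ ≢ v₄
      d₄₀ : v₄ ≢ v₀
      d₁₃ : v₁ ≢ v₃
      d₃₅ : v₃ ≢ v₅
      d₅₁ : v₅ ≢ v₁

  rotate : Hexagon → Hexagon
  rotate h = record
    { e₀₁ = e₅₀ ; e₁₂ = e₀₁ ; e₂₃ = e₁₂ ; e₃₄ = e₂₃ ; e₄₅ = e₃₄ ; e₅₀ = e₄₅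
    ; d₀₂ = d₅₁ ; d₂₄ = d₁₃ ; d₄₀ = d₃₅ ; d₁₃ = d₀₂ ; d₃₅ = d₂₄ ; d₅₁ = d₄₀ }
    where open Hexagon h

  -- The reflection fixing v₂ and v₅.
  reflect : Hexagon → Hexagon
  reflect h = record
    { e₀₁ = ~-sym e₃₄ ; e₁₂ = ~-sym e₂₃ ; e₂₃ = ~-sym e₁₂
    ; e₃₄ = ~-sym e₀₁ ; e₄₅ = ~-sym e₅₀ ; e₅₀ = ~-sym e₄₅
    ; d₀₂ = ≢-sym d₂₄ ; d₂₄ = ≢-sym d₀₂ ; d₄₀ = ≢-sym d₄₀
    ; d₁₃ = ≢-sym d₁₃ ; d₃₅ = ≢-sym d₅₁ ; d₅₁ = ≢-sym d₃₅ }
    where open Hexagon h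

  module _ (no-square : ¬ Square) where

    one-common-neighbour : ∀ {u v x y} → u ≢ v → x ~ u → x ~ v → y ~ u → y ~ v → x ≡ y
    one-common-neighbour u≢v xu xv yu yv = decidable-stable em λ x≢y →
      no-square (record { pq = ~-sym xu ; qr = xv ; rs = ~-sym yv ; sp = yu ; p≢r = u≢v ; q≢s = x≢y })

    module HexagonMove (h : Hexagon) where

      open Hexagon h

      -- Both `v₀` and `w` are pendant at `v₁` on the path `v₁ v₂ v₃ v₄`: an edge to `v₃` would
      -- close a square with `v₁` and `v₂`. Since `v₅` is left free, its image can be a new vertex.
      move : ∀ {w} → v₁ ~ w → w ≢ v₀ → w ≢ v₂ →
        Σ[ ψ ∈ BipartiteAutomorphism P ]
          (Auto.to ψ v₁ ≡ v₁ × Auto.to ψ v₂ ≡ v₂ × Auto.to ψ v₃ ≡ v₃ × Auto.to ψ v₄ ≡ v₄) ×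
          Auto.to ψ v₀ ≡ w
      move {w} v₁w w≢v₀ w≢v₂
        = let ψ , fixes , v₀↦w = move-leaf (path-grown path) (here refl) e₀₁ (~-sym v₁w) others
          in ψ , (fixes (here refl) , fixes (there (here refl)) , fixes (there (there (here refl))) ,
                  fixes (there (there (there (here refl))))) , v₀↦w
        where
        v₁≢v₄ : v₁ ≢ v₄
        v₁≢v₄ = three-apart e₁₂ e₂₃ e₃₄
        path : Path v₁ v₄ (v₁ ∷ v₂ ∷ v₃ ∷ v₄ ∷ [])
        path = go e₁₂ (λ { (here eq) → ~⇒≢ e₁₂ eq ; (there (here eq)) → d₁₃ eq ; (there (there (here eq))) → v₁≢v₄ eq })
              (go e₂₃ (λ { (here eq) → ~⇒≢ e₂₃ eq ; (there (here eq)) → d₂₄ eq })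
              (go e₃₄ (λ { (here eq) → ~⇒≢ e₃₄ eq }) stop))
        v₀≁v₃ : ¬ v₀ ~ v₃
        v₀≁v₃ e = d₀₂ (one-common-neighbour d₁₃ e₀₁ e (~-sym e₁₂) e₂₃)
        w≁v₃ : ¬ w ~ v₃
        w≁v₃ e = w≢v₂ (one-common-neighbour d₁₃ (~-sym v₁w) e (~-sym e₁₂) e₂₃)
        w≢v₄ : w ≢ v₄
        w≢v₄ eq = w≁v₃ (subst (_~ v₃) (sym eq) (~-sym e₃₄))
        w-part : part w ≡ part v₂
        w-part = same-part v₁w e₁₂
        others : ∀ {v} → v ∈ v₁ ∷ v₂ ∷ v₃ ∷ v₄ ∷ [] → v ≢ v₁ → v₀ ≢ v × w ≢ v × ¬ v₀ ~ v × ¬ w ~ v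
        others (here refl) v≢v₁ = ⊥-elim (v≢v₁ refl)
        others (there (here refl)) _ =
          d₀₂ , w≢v₂ , two-apart (~-sym e₀₁) e₁₂ , two-apart v₁w e₁₂
        others (there (there (here refl))) _ =
          three-apart e₀₁ e₁₂ e₂₃ , three-apart (~-sym v₁w) e₁₂ e₂₃ , v₀≁v₃ , w≁v₃
        others (there (there (there (here refl)))) _ =
          ≢-sym d₄₀ , w≢v₄ , two-apart e₅₀ (~-sym e₄₅) ,
          same-part⇒≁ (trans w-part (same-part (~-sym e₂₃) e₃₄))

      -- The third neighbour of `v₄` is the image `u` of `v₅`: if `u` were `v₅`, then `v₅` and `v₁`
      -- would have the two common neighbours `v₀` and `w`. As `v₁` and `v₄` lie in different parts,
      -- this spreads the property to both parts.
      opposite-three : ThreeNeighbours v₁ → ThreeNeighbours v₄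
      opposite-three three with three v₀ v₂
      ... | w , v₁w , w≢v₀ , w≢v₂ with move v₁w w≢v₀ w≢v₂
      ...   | ψ , (_ , _ , ψv₃ , ψv₄) , v₀↦w =
        three-neighbours (~-sym e₃₄) e₄₅ v₄u d₃₅
          (λ eq → d₃₅ (ψ.to-injective (trans ψv₃ eq)))
          (λ eq → w≢v₀ (one-common-neighbour d₅₁ (~-sym (subst (_~ w) (sym eq) uw)) (~-sym v₁w) (~-sym e₅₀) e₀₁))
        where
        module ψ = Auto ψ
        u : Vertex Γ
        u = ψ.to v₅
        uw : u ~ w
        uw = subst (u ~_) v₀↦w (ψ.to-~ e₅₀)
        v₄u : v₄ ~ u
        v₄u = subst (_~ u) ψv₄ (ψ.to-~ e₄₅)

      all-three′ : ThreeNeighbours v₁ → ∀ v → ThreeNeighbours v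
      all-three′ three v with part-cover e₁₂ v
      ... | inj₁ eq = three-neighbours-transport eq three
      ... | inj₂ eq = three-neighbours-transport (trans (same-part e₃₄ (~-sym e₂₃)) eq) (opposite-three three)

    all-three : Hexagon → ∃ ThreeNeighbours → ∀ v → ThreeNeighbours v
    all-three h (s , three) with part-cover (Hexagon.e₀₁ h) s
    ... | inj₁ eq = HexagonMove.all-three′ (rotate h) (three-neighbours-transport (sym eq) three)
    ... | inj₂ eq = HexagonMove.all-three′ h (three-neighbours-transport (sym eq) three)

    module Branch (h : Hexagon) {w₄ w₅ w₅′ : Vertex Γ} (v₃w₄ : Hexagon.v₃ h ~ w₄)
                  (w₄≢v₂ : w₄ ≢ Hexagon.v₂ h) (w₄≢v₄ : w₄ ≢ Hexagon.v₄ h) (w₄w₅ : w₄ ~ w₅)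
                  (w₅v₀ : w₅ ~ Hexagon.v₀ h) (w₅≢v₃ : w₅ ≢ Hexagon.v₃ h) (w₄w₅′ : w₄ ~ w₅′)
                  (w₅′≢v₃ : w₅′ ≢ Hexagon.v₃ h) (w₅′≢w₅ : w₅′ ≢ w₅) where

      open Hexagon h

      v₁≢v₄ : v₁ ≢ v₄
      v₁≢v₄ = three-apart e₁₂ e₂₃ e₃₄
      v₂≢v₅ : v₂ ≢ v₅
      v₂≢v₅ = three-apart e₂₃ e₃₄ e₄₅

      path : Path v₁ v₅ (v₁ ∷ v₂ ∷ v₃ ∷ v₄ ∷ v₅ ∷ [])
      path = go e₁₂ (λ { (here eq) → ~⇒≢ e₁₂ eq ; (there (here eq)) → d₁₃ eq
                       ; (there (there (here eq))) → v₁≢v₄ eq ; (there (there (there (here eq)))) → d₅₁ (sym eq) })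
            (go e₂₃ (λ { (here eq) → ~⇒≢ e₂₃ eq ; (there (here eq)) → d₂₄ eq ; (there (there (here eq))) → v₂≢v₅ eq })
            (go e₃₄ (λ { (here eq) → ~⇒≢ e₃₄ eq ; (there (here eq)) → d₃₅ eq })
            (go e₄₅ (λ { (here eq) → ~⇒≢ e₄₅ eq }) stop)))

      w₄∉ : w₄ ∉ v₁ ∷ v₂ ∷ v₃ ∷ v₄ ∷ v₅ ∷ []
      w₄∉ (here eq)                                 = three-apart (~-sym v₃w₄) (~-sym e₂₃) (~-sym e₁₂) eq
      w₄∉ (there (here eq))                         = w₄≢v₂ eq
      w₄∉ (there (there (here eq)))                 = ~⇒≢ (~-sym v₃w₄) eq
      w₄∉ (there (there (there (here eq))))         = w₄≢v₄ eq
      w₄∉ (there (there (there (there (here eq))))) = three-apart (~-sym v₃w₄) e₃₄ e₄₅ eq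

      -- The hexagon opened at `v₀`, with `w₄` pendant at `v₃`. Including `v₀` would block the move,
      -- since it distinguishes `w₅` from `w₅′`.
      tree : List (Vertex Γ)
      tree = w₄ ∷ v₁ ∷ v₂ ∷ v₃ ∷ v₄ ∷ v₅ ∷ []

      away : ∀ {z} → w₄ ~ z → z ≢ v₃ → ∀ {v} → v ∈ tree → v ≢ w₄ → z ≢ v × ¬ z ~ v
      away w₄z z≢v₃ (here refl) v≢w₄ = ⊥-elim (v≢w₄ refl)
      away w₄z z≢v₃ (there (here refl)) _ =
        (λ { refl → w₄≢v₂ (one-common-neighbour d₁₃ w₄z (~-sym v₃w₄) (~-sym e₁₂) e₂₃) }) ,
        same-part⇒≁ (trans (same-part w₄z (~-sym v₃w₄)) (same-part e₂₃ (~-sym e₁₂)))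
      away w₄z z≢v₃ (there (there (here refl))) _ =
        three-apart (~-sym w₄z) (~-sym v₃w₄) (~-sym e₂₃) ,
        λ e → z≢v₃ (one-common-neighbour w₄≢v₂ (~-sym w₄z) e v₃w₄ (~-sym e₂₃))
      away w₄z z≢v₃ (there (there (there (here refl)))) _ =
        z≢v₃ , two-apart w₄z (~-sym v₃w₄)
      away w₄z z≢v₃ (there (there (there (there (here refl))))) _ =
        three-apart (~-sym w₄z) (~-sym v₃w₄) e₃₄ ,
        λ e → z≢v₃ (one-common-neighbour w₄≢v₄ (~-sym w₄z) e v₃w₄ e₃₄)
      away w₄z z≢v₃ (there (there (there (there (there (here refl)))))) _ =
        (λ { refl → w₄≢v₄ (one-common-neighbour d₃₅ (~-sym v₃w₄) w₄z (~-sym e₃₄) e₄₅) }) ,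
        same-part⇒≁ (trans (same-part w₄z (~-sym v₃w₄)) (same-part (~-sym e₃₄) e₄₅))

      grown : Grown tree
      grown = grow (~-sym v₃w₄) (there (there (here refl))) w₄∉ (path-grown path)

      module _ (ψ : BipartiteAutomorphism P) (fixes : ∀ {v} → v ∈ tree → Auto.to ψ v ≡ v)
               (w₅↦w₅′ : Auto.to ψ w₅ ≡ w₅′) where
        private
          module ψ = Auto ψ
        w₄≢v₀ : w₄ ≢ v₀
        w₄≢v₀ eq = w₄≢v₂ (one-common-neighbour d₁₃ (subst (_~ v₁) (sym eq) e₀₁) (~-sym v₃w₄) (~-sym e₁₂) e₂₃)
        ψv₀ : ψ.to v₀ ≡ v₀
        ψv₀ = one-common-neighbour d₅₁
          (subst (ψ.to v₀ ~_) (fixes (there (there (there (there (there (here refl))))))) (ψ.to-~ (~-sym e₅₀)))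
          (subst (ψ.to v₀ ~_) (fixes (there (here refl))) (ψ.to-~ e₀₁))
          (~-sym e₅₀) e₀₁
        w₅′v₀ : w₅′ ~ v₀
        w₅′v₀ = subst₂ _~_ w₅↦w₅′ ψv₀ (ψ.to-~ w₅v₀)

        clash : ⊥
        clash = w₅′≢w₅ (one-common-neighbour w₄≢v₀ (~-sym w₄w₅′) w₅′v₀ (~-sym w₄w₅) w₅v₀)

      contra : ⊥
      contra =
        let ψ , fixes , w₅↦w₅′ = move-leaf grown (here refl) (~-sym w₄w₅) (~-sym w₄w₅′)
              (λ v∈ v≢ → let z≢ , z≁ = away w₄w₅ w₅≢v₃ v∈ v≢ ; z′≢ , z′≁ = away w₄w₅′ w₅′≢v₃ v∈ v≢
                         in z≢ , z′≢ , z≁ , z′≁)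
        in clash ψ fixes w₅↦w₅′

    -- v₀ is the only common neighbour of v₁ and v₅, so it is fixed together with
    -- the path v₁ … v₅.  But v₃ has a neighbour w₄ with both a neighbour w₅ at
    -- v₀ and a neighbour w₅′ away from v₀, and w₅ can be moved to w₅′.
    no-hexagon : ∃ ThreeNeighbours → ¬ Hexagon
    no-hexagon some-three h =
      let open Hexagon h
          three = all-three h some-three
          w₄ , v₃w₄ , w₄≢v₂ , w₄≢v₄ = three v₃ v₂ v₄
          -- In the reflected hexagon `move` fixes `v₃`, `v₂`, `v₁`, `v₀` and takes `v₄` to `w₄`;
          -- the image `w₅` of `v₅` then completes a second hexagon over the same path.
          ψ , (ψv₃ , _ , _ , ψv₀) , v₄↦w₄ = HexagonMove.move (reflect h) v₃w₄ w₄≢v₄ w₄≢v₂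
          w₅ = Auto.to ψ v₅
          w₅′ , w₄w₅′ , w₅′≢v₃ , w₅′≢w₅ = three w₄ v₃ w₅
      in Branch.contra h v₃w₄ w₄≢v₂ w₄≢v₄
           (subst (_~ w₅) v₄↦w₄ (Auto.to-~ ψ e₄₅))
           (subst (w₅ ~_) ψv₀ (Auto.to-~ ψ e₅₀))
           (λ eq → d₃₅ (sym (Auto.to-injective ψ (trans eq (sym ψv₃)))))
           w₄w₅′ w₅′≢v₃ w₅′≢w₅

-- Trees and cycles

hasDegree-≅ : ∀ {ℓ₁ ℓ₂} {G : Graph ℓ₁} {H : Graph ℓ₂} (ι : G ≅ H) {v d} →
              HasDegree G v d → HasDegree H (_≅_.to ι v) d
hasDegree-≅ {G = G} {H} ι {v} (ns , uniq , len , adj) =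
  map to ns , Unique.map⁺ to-injective uniq , trans (length-map to ns) len , adj′
  where
  open Isomorphism ι
  adj′ : ∀ u → u ∈ map to ns ⇔ Graph._~_ H (to v) u
  adj′ u = mk⇔ hom hom⁻
    where
    hom : u ∈ map to ns → Graph._~_ H (to v) u
    hom u∈ with ∈-map⁻ to u∈
    ... | w , w∈ , refl = to-~ (Equivalence.to (adj w) w∈)
    hom⁻ : Graph._~_ H (to v) u → u ∈ map to ns
    hom⁻ e = subst (_∈ map to ns) (to∘from u) (∈-map⁺ to (Equivalence.from (adj (from u))
      (to-~⁻ (subst (Graph._~_ H (to v)) (sym (to∘from u)) e))))

flips : ℕ → Part → Part
flips zero    p = p
flips (suc k) p = other (flips k p)

other-involutive : ∀ p → other (other p) ≡ p
other-involutive X = refl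
other-involutive Y = refl

flips⇒even : ∀ k {p} → flips k p ≡ p → 2 ∣ k
flips⇒even zero          _  = divides 0 refl
flips⇒even (suc zero)    eq = ⊥-elim (other-≢ _ eq)
flips⇒even (suc (suc k)) eq with flips⇒even k (trans (sym (other-involutive _)) eq)
... | divides q k≡q*2 = divides (suc q) (cong (2 +_) k≡q*2)

even⇒flips : ∀ k {p} → 2 ∣ k → flips k p ≡ p
even⇒flips _ (divides q refl) = go q
  where
  go : ∀ q {p} → flips (q * 2) p ≡ p
  go zero    = refl
  go (suc q) = trans (other-involutive _) (go q)

-- The cyclic order on `Fin (suc n)`

module CyclicOrder (n : ℕ) where

  last : Fin (suc n)
  last = fromℕ n

  last-zero : Next (suc n) last zero
  last-zero = inj₂ (cong suc (Fin.toℕ-fromℕ n) , refl)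

  inject₁-suc : ∀ (i : Fin n) → Next (suc n) (inject₁ i) (suc i)
  inject₁-suc i = inj₁ (cong suc (Fin.toℕ-inject₁ i))

  successor : ∀ i → ∃[ j ] Next (suc n) i j
  successor i with toℕ i ℕ.≟ n
  ... | yes eq = zero , inj₂ (cong suc eq , refl)
  ... | no ne  = fromℕ< i< , inj₁ (sym (Fin.toℕ-fromℕ< i<))
    where
    i< : suc (toℕ i) < suc n
    i< = s≤s (ℕ.≤∧≢⇒< (Fin.toℕ≤pred[n] i) ne)

  predecessor : ∀ j → ∃[ i ] Next (suc n) i j
  predecessor zero    = last , last-zero
  predecessor (suc j) = inject₁ j , inject₁-suc j

  next prev : Fin (suc n) → Fin (suc n)
  next = proj₁ ∘ successor
  prev = proj₁ ∘ predecessor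

  Next-next : ∀ i → Next (suc n) i (next i)
  Next-next = proj₂ ∘ successor

  Next-prev : ∀ j → Next (suc n) (prev j) j
  Next-prev = proj₂ ∘ predecessor

  private
    overflow : ∀ {i j : Fin (suc n)} → suc (toℕ i) ≡ toℕ j → suc (toℕ i) ≡ suc n → ⊥
    overflow {j = j} eq eq′ = ℕ.<-irrefl (trans (sym eq) eq′) (Fin.toℕ<n j)

  Next-functional : ∀ {i j j′} → Next (suc n) i j → Next (suc n) i j′ → j ≡ j′
  Next-functional (inj₁ p)       (inj₁ q)        = Fin.toℕ-injective (trans (sym p) q)
  Next-functional {i} {j} (inj₁ p)       (inj₂ (q , _))  = ⊥-elim (overflow {i} {j} p q)
  Next-functional {i} {_} {j} (inj₂ (p , _)) (inj₁ q)        = ⊥-elim (overflow {i} {j} q p)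
  Next-functional (inj₂ (_ , p)) (inj₂ (_ , q))  = Fin.toℕ-injective (trans p (sym q))

  Next-injective : ∀ {i i′ j} → Next (suc n) i j → Next (suc n) i′ j → i ≡ i′
  Next-injective (inj₁ p)       (inj₁ q)       = Fin.toℕ-injective (ℕ.suc-injective (trans p (sym q)))
  Next-injective (inj₁ p)       (inj₂ (_ , q)) with trans p q
  ... | ()
  Next-injective (inj₂ (_ , p)) (inj₁ q)       with trans q p
  ... | ()
  Next-injective (inj₂ (p , _)) (inj₂ (q , _)) = Fin.toℕ-injective (ℕ.suc-injective (trans p (sym q)))

  Next-asym : 3 ≤ suc n → ∀ {i j} → Next (suc n) i j → Next (suc n) j i → ⊥
  Next-asym _ (inj₁ p) (inj₁ q) = ℕ.<-asym (ℕ.≤-reflexive p) (ℕ.≤-reflexive q)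
  Next-asym 3≤ (inj₁ p) (inj₂ (q , r)) = ℕ.<-irrefl (sym (trans (sym q) (cong suc (trans (sym p) (cong suc r))))) 3≤
  Next-asym 3≤ (inj₂ (p , r)) (inj₁ q) = ℕ.<-irrefl (sym (trans (sym p) (cong suc (trans (sym q) (cong suc r))))) 3≤
  Next-asym 3≤ (inj₂ (p , _)) (inj₂ (_ , r)) = ℕ.<-irrefl (sym (trans (sym p) (cong suc r))) (ℕ.≤-trans (s≤s (s≤s z≤n)) 3≤)

  next≢prev : 3 ≤ suc n → ∀ i → next i ≢ prev i
  next≢prev 3≤ i eq = Next-asym 3≤ (Next-next i) (subst (λ j → Next (suc n) j i) (sym eq) (Next-prev i))

-- Infinite trees and cycles among square-free graphs

module Sparse {ℓ : Level} (em : ExcludedMiddle ℓ) (Γ : Graph ℓ) (P : Bipartition Γ)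
              (homogeneous : ConnectedHomogeneous Γ P)
              (connected : Connected Γ) (locally-finite : LocallyFinite Γ) where

  open Graph Γ using (_~_; ~-sym; ~-irrefl)
  open Bipartition P using (part; proper)
  open Classification em Γ P homogeneous connected locally-finite
  open WithoutSquare em Γ P homogeneous connected locally-finite
  open Paths Γ
  open Counting _≟_ using (⊆⇒length≤)

  module _ (no-square : ¬ Square) (some-three : ∃ ThreeNeighbours) where

    -- The hypothesis of a strong induction on the number of vertices; it makes the closed path
    -- under study a shortest one.
    NoClosedPathBelow : ℕ → Set ℓ
    NoClosedPathBelow n = ∀ {a c l} → Path a c l → c ~ a → 3 ≤ length l → length l < n → ⊥

    -- In the closed path e d c v₂ … z, let w be a third neighbour of c.  No
    -- shorter path is closed, so d and w are attached to c … z in the same way,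
    -- and an automorphism fixing c … z and moving d to w takes e to a vertex u
    -- closing the hexagon w c d e z u.
    shorten : ∀ {n e d c z l} → NoClosedPathBelow n → e ~ d → d ~ c → Path c z l → z ~ e →
              e ∉ d ∷ l → d ∉ l → 2 + length l ≤ n → ThreeNeighbours c → ⊥
    shorten _ ed dc stop ze _ _ _ _ = two-apart ed (~-sym ze) dc
    shorten {n} {e} {d} {c} {z} below ed dc pc@(go {b = v₂} {l = l} cv₂ c∉l p) ze e∉ d∉ len three =
      no-hexagon no-square some-three (record
        { e₀₁ = ~-sym cw ; e₁₂ = ~-sym dc ; e₂₃ = ~-sym ed ; e₃₄ = ~-sym ze ; e₄₅ = zu ; e₅₀ = uw
        ; d₀₂ = w≢d ; d₂₄ = (λ { refl → d∉ (end∈ pc) }) ; d₄₀ = (λ { refl → w∉ (end∈ pc) })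
        ; d₁₃ = (λ { refl → e∉ (there (here refl)) }) ; d₃₅ = e≢u
        ; d₅₁ = (λ u≡c → e∉ (there (here (ψ.to-injective (trans u≡c (sym (fixes (here refl)))))))) })
      where
      third : ∃[ w ] c ~ w × w ≢ d × w ≢ v₂
      third = three d v₂
      w : Vertex Γ
      w = proj₁ third
      cw : c ~ w
      cw = proj₁ (proj₂ third)
      w≢d : w ≢ d
      w≢d = proj₁ (proj₂ (proj₂ third))
      w≢v₂ : w ≢ v₂
      w≢v₂ = proj₂ (proj₂ (proj₂ third))

      -- Otherwise the piece of the path from `c` to `w`, closed by the edge `c ~ w`, would be
      -- shorter.
      w∉ : w ∉ c ∷ l
      w∉ (here w≡c) = ~⇒≢ cw (sym w≡c)
      w∉ (there w∈l) with prefix p w∈l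
      ... | l′ , p′ , sub , len′ =
        below (go cv₂ (c∉l ∘ sub) p′) (~-sym cw) (s≤s (length-path p′ (≢-sym w≢v₂)))
              (ℕ.≤-trans (s≤s (s≤s (ℕ.≤-trans len′ (ℕ.n≤1+n _)))) len)

      -- Such an edge would close the path from `x` through `c` to `r`, which has at least one
      -- vertex fewer than the given closed path.
      no-chord : ∀ {x r} → x ~ c → x ∉ c ∷ l → r ∈ l → ¬ x ~ r
      no-chord xc x∉ r∈l xr with prefix p r∈l
      ... | l′ , p′ , sub , len′ =
        below (go xc (λ { (here eq) → x∉ (here eq) ; (there x∈) → x∉ (there (sub x∈)) }) (go cv₂ (c∉l ∘ sub) p′))
              (~-sym xr) (s≤s (s≤s (nonempty p′)))
              (ℕ.≤-trans (s≤s (s≤s (s≤s len′))) len)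
        where
        nonempty : ∀ {a c l} → Path a c l → 1 ≤ length l
        nonempty stop       = s≤s z≤n
        nonempty (go _ _ _) = s≤s z≤n

      moved : Σ[ ψ ∈ BipartiteAutomorphism P ] (∀ {v} → v ∈ c ∷ l → Auto.to ψ v ≡ v) × Auto.to ψ d ≡ w
      moved = move-leaf (path-grown pc) (here refl) dc (~-sym cw) λ
        { (here refl) v≢c → ⊥-elim (v≢c refl)
        ; (there v∈l) _   → (λ { refl → d∉ (there v∈l) }) , (λ { refl → w∉ (there v∈l) }) ,
                            no-chord dc d∉ v∈l , no-chord (~-sym cw) w∉ v∈l }

      module ψ = Auto (proj₁ moved)
      fixes : ∀ {v} → v ∈ c ∷ l → ψ.to v ≡ v
      fixes = proj₁ (proj₂ moved)
      u : Vertex Γ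
      u = ψ.to e
      uw : u ~ w
      uw = subst (u ~_) (proj₂ (proj₂ moved)) (ψ.to-~ ed)
      zu : z ~ u
      zu = subst (_~ u) (fixes (end∈ pc)) (ψ.to-~ ze)
      -- If `u` were `e`, then `d` and `w` would be two common neighbours of `c` and `e`.
      e≢u : e ≢ u
      e≢u e≡u = w≢d (one-common-neighbour no-square (λ { refl → e∉ (there (here refl)) })
        (~-sym cw) (~-sym (subst (_~ w) (sym e≡u) uw)) dc (~-sym ed))

    no-closed-path-below : ∀ n → NoClosedPathBelow n
    no-closed-path-below (suc n) {a} {c} {l} p ca 3≤ (s≤s len) = by-cases p ca 3≤ len
      where
      by-cases : ∀ {a c l} → Path a c l → c ~ a → 3 ≤ length l → length l ≤ n → ⊥
      by-cases stop _ (s≤s ()) _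
      by-cases (go _ _ stop) _ (s≤s (s≤s ())) _
      by-cases (go ed e∉ (go dc d∉ stop)) ze _ _ = two-apart ed (~-sym ze) dc
      by-cases (go ed e∉ (go dc d∉ pc@(go {l = l} cv₂ c∉ p))) ze _ len
        with part-cover dc (proj₁ some-three)
      ... | inj₂ eq = shorten (no-closed-path-below n) ed dc pc ze e∉ d∉ len
                        (three-neighbours-transport (sym eq) (proj₂ some-three))
      -- `shorten` asks for the third neighbour at `c`. When it is known for the part of `d`, the
      -- closed path is rotated by one step, and `v₂`, which lies in that part, takes the place of
      -- `c`.
      ... | inj₁ eq = shorten (no-closed-path-below n) dc cv₂ (snoc p ze (λ e∈ → e∉ (there (there e∈)))) ed
          (λ { (here d≡c) → ~⇒≢ dc d≡c ; (there d∈) →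
                [ (λ d∈l → d∉ (there d∈l)) , (λ { (here refl) → ~⇒≢ ed refl }) ] (∈-++⁻ l d∈) })
          (λ c∈ → [ c∉ , (λ { (here refl) → e∉ (there (here refl)) }) ] (∈-++⁻ l c∈))
          (subst (λ k → 2 + k ≤ n) (sym (trans (length-++ l) (ℕ.+-comm (length l) 1))) len)
          (three-neighbours-transport (trans (sym eq) (same-part (~-sym dc) cv₂)) (proj₂ some-three))

    acyclic : Acyclic Γ
    acyclic = no-closed-path⇒acyclic λ p ca 3≤ → no-closed-path-below _ p ca 3≤ ℕ.≤-refl

  -- A path can always be prolonged at its start by a neighbour other than the second vertex;
  -- meeting the path again would close it. So there are repetition-free lists of every length.
  no-closed-path⇒infinite : NoClosedPath → (∀ v → TwoNeighbours v) → Vertex Γ → Infinite Γ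
  no-closed-path⇒infinite none two v (vs , all) =
    let _ , _ , l , p , len = long (length vs)
    in ℕ.<-irrefl refl (ℕ.≤-trans (ℕ.≤-reflexive (sym len)) (⊆⇒length≤ (path-unique p) (λ {x} _ → all x)))
    where
    prepend : ∀ {a c l} → Path a c l → ∃[ w ] Path w c (w ∷ l)
    prepend {a} stop = let w , aw , _ = two a a in w , go (~-sym aw) (λ { (here w≡a) → ~⇒≢ aw (sym w≡a) }) stop
    prepend {a} (go {b = b} {l = l} ab a∉ p) = let w , aw , w≢b = two a b in w , go (~-sym aw) (fresh aw w≢b) (go ab a∉ p)
      where
      fresh : ∀ {w} → a ~ w → w ≢ b → w ∉ a ∷ l
      fresh aw _   (here refl) = ~-irrefl aw
      fresh aw w≢b (there w∈) with prefix p w∈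
      ... | _ , p′ , sub , _ = none (go ab (a∉ ∘ sub) p′) (~-sym aw) (s≤s (length-path p′ (≢-sym w≢b)))
    long : ∀ n → ∃[ a ] ∃[ c ] ∃[ l ] Path a c l × length l ≡ suc n
    long zero    = v , v , v ∷ [] , stop , refl
    long (suc n) = let _ , c , l , p , len = long n ; w , q = prepend p in w , c , w ∷ l , q , cong suc len

  -- Automorphisms are transitive on each part, so one representative determines the degree of its
  -- part. The tree is the graph itself.
  acyclic⇒tree : Acyclic Γ → InducedPath₄ →
    Σ[ a ∈ ℕ ] Σ[ b ∈ ℕ ] Σ[ T ∈ Graph ℓ ] (IsInfiniteSemiregularTree a b T × Γ ≅ T)
  acyclic⇒tree acyclic path = degree-of X , degree-of Y , Γ ,
    (connected , acyclic ,
     no-closed-path⇒infinite (acyclic⇒no-closed-path acyclic) (induced-path⇒two-neighbours path) a ,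
     P , has-degree X , has-degree Y) , ≅-refl
    where
    open InducedPath₄ path
    vertex-in : ∀ p → ∃[ v ] part v ≡ p
    vertex-in p with part a ≟ᴾ p
    ... | yes eq = a , eq
    ... | no ne  = b , ≢-≢⇒≡ (≢-sym (proper ab)) ne
    degree-of : Part → ℕ
    degree-of p = proj₁ (locally-finite (proj₁ (vertex-in p)))
    has-degree : ∀ p v → part v ≡ p → HasDegree Γ v (degree-of p)
    has-degree p v eq =
      let ψ , u↦v = move-vertex (trans (proj₂ (vertex-in p)) (sym eq))
      in subst (λ v → HasDegree Γ v (degree-of p)) u↦v
           (hasDegree-≅ (BipartiteAutomorphism.automorphism ψ) (proj₂ (locally-finite (proj₁ (vertex-in p)))))

  -- A vertex of an embedded cycle has two neighbours on it; without a third one, no walk leaves the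
  -- cycle. Its length is even because the parts alternate along it.
  cyclic⇒cycle : ¬ (∃ ThreeNeighbours) → ¬ Acyclic Γ →
    Σ[ m ∈ ℕ ] Σ[ 3≤m ∈ 3 ≤ m ] (2 ∣ m × Γ ≅ Cycle m 3≤m)
  cyclic⇒cycle no-three cyclic
    with em {Σ[ m ∈ ℕ ] Σ[ 3≤m ∈ 3 ≤ m ] Σ[ f ∈ (Fin m → Vertex Γ) ]
               Injective _≡_ _≡_ f × (∀ i j → Graph._~_ (Cycle m 3≤m) i j → f i ~ f j)}
  ... | no none = ⊥-elim (cyclic λ m 3≤m c → none (m , 3≤m , c))
  ... | yes (suc n , 3≤m , f , inj , adj) = suc n , 3≤m , even , ≅-sym (record
    { bijection = mk↔ₛ′ f (proj₁ ∘ covered) (proj₂ ∘ covered) (λ i → inj (proj₂ (covered (f i))))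
    ; adjacency = λ i j → mk⇔ (adj i j) (adj⁻ i j) })
    where
    open CyclicOrder n
    step : ∀ {i j} → Next (suc n) i j → f i ~ f j
    step nx = adj _ _ (inj₁ nx)
    around : ∀ i {w} → f i ~ w → f (next i) ≡ w ⊎ f (prev i) ≡ w
    around i {w} e with f (next i) ≟ w | f (prev i) ≟ w
    ... | yes eq | _      = inj₁ eq
    ... | no _   | yes eq = inj₂ eq
    ... | no ne  | no ne′ = ⊥-elim (no-three (f i ,
      three-neighbours (step (Next-next i)) (~-sym (step (Next-prev i))) e (next≢prev 3≤m i ∘ inj) ne ne′))
    covered : ∀ v → ∃[ i ] f i ≡ v
    covered v = walk (connected (f zero) v) (zero , refl)
      where
      walk : ∀ {u v} → Star _~_ u v → ∃[ i ] f i ≡ u → ∃[ i ] f i ≡ v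
      walk ε r = r
      walk (e ◅ es) (i , refl) = walk es ([ (λ eq → next i , eq) , (λ eq → prev i , eq) ]′ (around i e))
    adj⁻ : ∀ i j → f i ~ f j → Graph._~_ (Cycle (suc n) 3≤m) i j
    adj⁻ i j e with around i e
    ... | inj₁ eq = inj₁ (subst (Next (suc n) i) (inj eq) (Next-next i))
    ... | inj₂ eq = inj₂ (subst (λ j → Next (suc n) j i) (inj eq) (Next-prev i))
    alternate : ∀ i → part (f i) ≡ flips (toℕ i) (part (f zero))
    alternate = <-weakInduction _ refl λ i ih →
      trans (≢⇒other (proper (step (inject₁-suc i))))
            (cong other (trans ih (cong (λ k → flips k (part (f zero))) (Fin.toℕ-inject₁ i))))
    even : 2 ∣ suc n
    even = flips⇒even (suc n) (sym (trans (≢⇒other (proper (step last-zero)))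
      (cong other (trans (alternate last) (cong (λ k → flips k (part (f zero))) (Fin.toℕ-fromℕ n))))))

-- One-point extensions

module OnePointExtensions {ℓ : Level} (em : ExcludedMiddle ℓ) (Γ : Graph ℓ) (connected : Connected Γ)
    (P : Bipartition Γ) (degree : Part → ℕ)
    (has-degree : ∀ v → HasDegree Γ v (degree (Bipartition.part P v))) where

  open Graph Γ using (_~_; ~-sym; ~-irrefl)
  open Bipartition P using (part; proper)
  open Paths Γ

  _≟_ : DecidableEquality (Vertex Γ)
  u ≟ v = em

  open Counting _≟_

  neighbours : Vertex Γ → List (Vertex Γ)
  neighbours v = proj₁ (has-degree v)

  neighbours-unique : ∀ v → Unique (neighbours v)
  neighbours-unique v = proj₁ (proj₂ (has-degree v))

  length-neighbours : ∀ {u v} → part u ≡ part v → length (neighbours u) ≡ length (neighbours v)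
  length-neighbours {u} {v} eq = trans (proj₁ (proj₂ (proj₂ (has-degree u))))
    (trans (cong degree eq) (sym (proj₁ (proj₂ (proj₂ (has-degree v))))))

  ∈-neighbours⁻ : ∀ {v u} → u ∈ neighbours v → v ~ u
  ∈-neighbours⁻ {v} = Equivalence.to (proj₂ (proj₂ (proj₂ (has-degree v))) _)

  ∈-neighbours⁺ : ∀ {v u} → v ~ u → u ∈ neighbours v
  ∈-neighbours⁺ {v} = Equivalence.from (proj₂ (proj₂ (proj₂ (has-degree v))) _)

  -- Pigeonhole: on the neighbours of `a` other than `v`, any map `h` takes fewer values than `b`
  -- has neighbours. Nothing is asked of `h`, neither injectivity nor that its values be neighbours
  -- of `b`.
  unhit-neighbour : ∀ {a b v} (h : Vertex Γ → Vertex Γ) → part a ≡ part b → a ~ v →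
                    ∃[ w ] b ~ w × (∀ {u} → a ~ u → u ≢ v → h u ≢ w)
  unhit-neighbour {a} {b} {v} h eq av = decidable-stable em λ none →
    ℕ.<-irrefl refl (ℕ.≤-trans (length-without (neighbours a) (∈-neighbours⁺ av))
      (ℕ.≤-trans (ℕ.≤-reflexive (length-neighbours eq))
      (ℕ.≤-trans (⊆⇒length≤ (neighbours-unique b) (hit none))
                 (ℕ.≤-reflexive (length-map h (neighbours a without v))))))
    where
    hit : ¬ (∃[ w ] b ~ w × (∀ {u} → a ~ u → u ≢ v → h u ≢ w)) →
          neighbours b ⊆ map h (neighbours a without v)
    hit none {w} w∈ = decidable-stable em λ w∉ →
      none (w , ∈-neighbours⁻ w∈ , λ au u≢v hu≡w →
        w∉ (subst (_∈ _) hu≡w (∈-map⁺ h (∈-without⁺ (∈-neighbours⁺ au) u≢v))))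

  -- The function `f` is total, but only its values on `A` are constrained; `linked` is
  -- connectedness of the subgraph induced on `A`.
  record PartialEmbedding (A : List (Vertex Γ)) (f : Vertex Γ → Vertex Γ) : Set ℓ where
    field
      injective : ∀ {u v} → u ∈ A → v ∈ A → f u ≡ f v → u ≡ v
      adjacency : ∀ {u v} → u ∈ A → v ∈ A → u ~ v ⇔ f u ~ f v
      preserves : ∀ {v} → v ∈ A → part (f v) ≡ part v
      linked    : ∀ {u v} → u ∈ A → v ∈ A → Star (Inside A) u v

    hom : ∀ {u v} → u ∈ A → v ∈ A → u ~ v → f u ~ f v
    hom u∈ v∈ = Equivalence.to (adjacency u∈ v∈)

    hom⁻ : ∀ {u v} → u ∈ A → v ∈ A → f u ~ f v → u ~ v
    hom⁻ u∈ v∈ = Equivalence.from (adjacency u∈ v∈)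

  OnePointExtension : Set ℓ
  OnePointExtension = ∀ {A f a v} → PartialEmbedding A f → a ∈ A → a ~ v → v ∉ A →
    ∃[ w ] part w ≡ part v × (∀ {u} → u ∈ A → f u ≢ w) × (∀ {u} → u ∈ A → v ~ u ⇔ w ~ f u)

  outside-neighbour : ∀ {A f a v} → PartialEmbedding A f → a ∈ A → a ~ v → v ∉ A →
    ∃[ w ] f a ~ w × part w ≡ part v × (∀ {u} → u ∈ A → f u ≢ w)
  outside-neighbour {f = f} {a} {v} emb a∈ av v∉ =
    let w , faw , unhit = unhit-neighbour f (sym (preserves a∈)) av
    in w , faw , ≢-≢⇒≡ (≢-sym (proper faw)) (subst (_≢ part v) (sym (preserves a∈)) (proper av)) ,
       λ u∈ fu≡w → unhit (hom⁻ a∈ u∈ (subst (f a ~_) (sym fu≡w) faw)) (λ { refl → v∉ u∈ }) fu≡w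
    where open PartialEmbedding emb

  module Extend (extension : OnePointExtension) where

    record Stage : Set ℓ where
      field
        dom : List (Vertex Γ)
        fun : Vertex Γ → Vertex Γ
        emb : PartialEmbedding dom fun
      open PartialEmbedding emb public
    open Stage using (dom; fun)

    infix 4 _⊑_
    _⊑_ : Stage → Stage → Set ℓ
    s ⊑ t = ∀ {v} → v ∈ dom s → v ∈ dom t × fun t v ≡ fun s v

    ⊑-trans : ∀ {s t u} → s ⊑ t → t ⊑ u → s ⊑ u
    ⊑-trans s⊑t t⊑u v∈ =
      let v∈t , eq = s⊑t v∈ ; v∈u , eq′ = t⊑u v∈t in v∈u , trans eq′ eq

    add-vertex : ∀ s {a v} → a ∈ dom s → a ~ v → v ∉ dom s → ∃[ t ] s ⊑ t × v ∈ dom t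
    add-vertex s {a} {v} a∈ av v∉ = add (extension (Stage.emb s) a∈ av v∉)
      where
      open Stage s hiding (dom; fun)
      A : List (Vertex Γ)
      A = dom s
      f : Vertex Γ → Vertex Γ
      f = fun s
      module _ (w : Vertex Γ) (w-part : part w ≡ part v) (fresh : ∀ {u} → u ∈ A → f u ≢ w)
               (adj : ∀ {u} → u ∈ A → v ~ u ⇔ w ~ f u) where
        g : Vertex Γ → Vertex Γ
        g = update f v w
        g-new : g v ≡ w
        g-new = update-self f v w
        g-old : ∀ {u} → u ∈ A → g u ≡ f u
        g-old u∈ = update-other f v w λ { refl → v∉ u∈ }
        inj : ∀ {x y} → x ∈ v ∷ A → y ∈ v ∷ A → g x ≡ g y → x ≡ y
        inj (here refl) (here refl) _  = refl
        inj (here refl) (there y∈)  eq = ⊥-elim (fresh y∈ (trans (sym (g-old y∈)) (trans (sym eq) g-new)))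
        inj (there x∈)  (here refl) eq = ⊥-elim (fresh x∈ (trans (sym (g-old x∈)) (trans eq g-new)))
        inj (there x∈)  (there y∈)  eq = injective x∈ y∈ (trans (sym (g-old x∈)) (trans eq (g-old y∈)))
        to : ∀ {x y} → x ∈ v ∷ A → y ∈ v ∷ A → x ~ y → g x ~ g y
        to (here refl) (here refl) e = ⊥-elim (~-irrefl e)
        to (here refl) (there y∈)  e = subst₂ _~_ (sym g-new) (sym (g-old y∈)) (Equivalence.to (adj y∈) e)
        to (there x∈)  (here refl) e = subst₂ _~_ (sym (g-old x∈)) (sym g-new) (~-sym (Equivalence.to (adj x∈) (~-sym e)))
        to (there x∈)  (there y∈)  e = subst₂ _~_ (sym (g-old x∈)) (sym (g-old y∈)) (hom x∈ y∈ e)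
        from : ∀ {x y} → x ∈ v ∷ A → y ∈ v ∷ A → g x ~ g y → x ~ y
        from (here refl) (here refl) e = ⊥-elim (~-irrefl e)
        from (here refl) (there y∈)  e = Equivalence.from (adj y∈) (subst₂ _~_ g-new (g-old y∈) e)
        from (there x∈)  (here refl) e = ~-sym (Equivalence.from (adj x∈) (~-sym (subst₂ _~_ (g-old x∈) g-new e)))
        from (there x∈)  (there y∈)  e = hom⁻ x∈ y∈ (subst₂ _~_ (g-old x∈) (g-old y∈) e)
        prt : ∀ {x} → x ∈ v ∷ A → part (g x) ≡ part x
        prt (here refl) = trans (cong part g-new) w-part
        prt (there x∈)  = trans (cong part (g-old x∈)) (preserves x∈)
        old : ∀ {x y} → x ∈ A → y ∈ A → Star (Inside (v ∷ A)) x y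
        old x∈ y∈ = gmap id (λ (e , p , q) → e , there p , there q) (linked x∈ y∈)
        link : ∀ {x y} → x ∈ v ∷ A → y ∈ v ∷ A → Star (Inside (v ∷ A)) x y
        link (here refl) (here refl) = ε
        link (here refl) (there y∈)  = (~-sym av , here refl , there a∈) ◅ old a∈ y∈
        link (there x∈)  (here refl) = old x∈ a∈ ◅◅ ((av , there a∈ , here refl) ◅ ε)
        link (there x∈)  (there y∈)  = old x∈ y∈
      add : ∃[ w ] part w ≡ part v × (∀ {u} → u ∈ A → f u ≢ w) × (∀ {u} → u ∈ A → v ~ u ⇔ w ~ f u) →
            ∃[ t ] s ⊑ t × v ∈ dom t
      add (w , w-part , fresh , adj) =
        record { dom = v ∷ A ; fun = g w w-part fresh adj ; emb = record
          { injective = inj w w-part fresh adj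
          ; adjacency = λ x∈ y∈ → mk⇔ (to w w-part fresh adj x∈ y∈) (from w w-part fresh adj x∈ y∈)
          ; preserves = prt w w-part fresh adj
          ; linked    = link w w-part fresh adj } } ,
        (λ u∈ → there u∈ , g-old w w-part fresh adj u∈) , here refl

    absorb-vertex : ∀ s v → ∃[ t ] s ⊑ t × (∀ {a} → a ∈ dom s → a ~ v → v ∈ dom t)
    absorb-vertex s v with em {v ∈ dom s} | em {∃[ a ] a ∈ dom s × a ~ v}
    ... | yes v∈ | _  = s , (λ u∈ → u∈ , refl) , λ _ _ → v∈
    ... | no _ | no ¬a = s , (λ u∈ → u∈ , refl) , λ a∈ av → ⊥-elim (¬a (_ , a∈ , av))
    ... | no v∉ | yes (a , a∈ , av) =
      let t , s⊑t , v∈ = add-vertex s a∈ av v∉ in t , s⊑t , λ _ _ → v∈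

    absorb : ∀ s vs → ∃[ t ] s ⊑ t × (∀ {a v} → a ∈ dom s → v ∈ vs → a ~ v → v ∈ dom t)
    absorb s []       = s , (λ u∈ → u∈ , refl) , λ _ ()
    absorb s (v ∷ vs) =
      let t , s⊑t , new = absorb-vertex s v
          t′ , t⊑t′ , new′ = absorb t vs
      in t′ , ⊑-trans {s} {t} {t′} s⊑t t⊑t′ , λ
           { a∈ (here refl) av → proj₁ (t⊑t′ (new a∈ av))
           ; a∈ (there v∈)  av → new′ (proj₁ (s⊑t a∈)) v∈ av }

    grow-stage : ∀ s → ∃[ t ] s ⊑ t × (∀ {a v} → a ∈ dom s → a ~ v → v ∈ dom t)
    grow-stage s =
      let t , s⊑t , new = absorb s (concatMap neighbours (dom s))
      in t , s⊑t , λ a∈ av → new a∈ (∈-concatMap⁺ neighbours (lose a∈ (∈-neighbours⁺ av))) av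

    module Limit (start : Stage) {root : Vertex Γ} (root∈ : root ∈ dom start) where

      stage : ℕ → Stage
      stage zero    = start
      stage (suc n) = proj₁ (grow-stage (stage n))

      stage-⊑ : ∀ k n → stage n ⊑ stage (k + n)
      stage-⊑ zero    n v∈ = v∈ , refl
      stage-⊑ (suc k) n    = ⊑-trans {stage n} {stage (k + n)} {stage (suc k + n)}
                               (stage-⊑ k n) (proj₁ (proj₂ (grow-stage (stage (k + n)))))

      reach : ∀ {u v} → Star _~_ u v → ∃[ n ] u ∈ dom (stage n) → ∃[ n ] v ∈ dom (stage n)
      reach ε        r        = r
      reach (e ◅ es) (n , u∈) = reach es (suc n , proj₂ (proj₂ (grow-stage (stage n))) u∈ e)

      abstract
        reached : ∀ v → ∃[ n ] v ∈ dom (stage n)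
        reached v = reach (connected root v) (0 , root∈)

      time : Vertex Γ → ℕ
      time v = proj₁ (reached v)

      limit : Vertex Γ → Vertex Γ
      limit v = fun (stage (time v)) v

      agrees : ∀ v k → v ∈ dom (stage (k + time v)) × fun (stage (k + time v)) v ≡ limit v
      agrees v k = stage-⊑ k (time v) (proj₂ (reached v))

      joint : ∀ u v → ∃[ s ] (u ∈ dom s × fun s u ≡ limit u) × (v ∈ dom s × fun s v ≡ limit v)
      joint u v = stage (time u + time v) ,
        subst (λ k → u ∈ dom (stage k) × fun (stage k) u ≡ limit u) (ℕ.+-comm (time v) (time u)) (agrees u (time v)) ,
        agrees v (time u)

      limit-injective : Injective _≡_ _≡_ limit
      limit-injective {u} {v} eq =
        let s , (u∈ , equ) , (v∈ , eqv) = joint u v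
        in Stage.injective s u∈ v∈ (trans equ (trans eq (sym eqv)))

      limit-~ : ∀ {u v} → u ~ v → limit u ~ limit v
      limit-~ {u} {v} e =
        let s , (u∈ , equ) , (v∈ , eqv) = joint u v
        in subst₂ _~_ equ eqv (Stage.hom s u∈ v∈ e)

      limit-~⁻ : ∀ {u v} → limit u ~ limit v → u ~ v
      limit-~⁻ {u} {v} e =
        let s , (u∈ , equ) , (v∈ , eqv) = joint u v
        in Stage.hom⁻ s u∈ v∈ (subst₂ _~_ (sym equ) (sym eqv) e)

      limit-part : ∀ v → part (limit v) ≡ part v
      limit-part v = Stage.preserves (stage (time v)) (proj₂ (reached v))

      limit-start : ∀ {v} → v ∈ dom start → limit v ≡ fun start v
      limit-start {v} v∈ = proj₂ (subst (λ k → v ∈ dom (stage k) × fun (stage k) v ≡ fun start v)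
                                        (ℕ.+-identityʳ (time v)) (stage-⊑ (time v) 0 v∈))

      -- The neighbours of `v` go injectively to neighbours of `limit v`, of which there are equally
      -- many, so none is left over.
      neighbour-hit : ∀ {v w} → limit v ~ w → ∃[ u ] limit u ≡ w
      neighbour-hit {v} {w} e = decidable-stable em λ unhit →
        ℕ.<-irrefl refl (ℕ.≤-trans (length-without (neighbours (limit v)) (∈-neighbours⁺ e))
          (ℕ.≤-trans (ℕ.≤-reflexive (trans (length-neighbours (limit-part v)) (sym (length-map limit (neighbours v)))))
                     (⊆⇒length≤ (Unique.map⁺ limit-injective (neighbours-unique v)) (into unhit))))
        where
        into : ¬ (∃[ u ] limit u ≡ w) → map limit (neighbours v) ⊆ neighbours (limit v) without w
        into unhit x∈ with ∈-map⁻ limit x∈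
        ... | u , u∈ , refl = ∈-without⁺ (∈-neighbours⁺ (limit-~ (∈-neighbours⁻ u∈))) (λ eq → unhit (u , eq))

      hit : ∀ w → ∃[ u ] limit u ≡ w
      hit w = walk (connected (limit root) w) (root , refl)
        where
        walk : ∀ {x y} → Star _~_ x y → ∃[ u ] limit u ≡ x → ∃[ u ] limit u ≡ y
        walk ε r                 = r
        walk (e ◅ es) (u , refl) = walk es (neighbour-hit e)

      automorphism : BipartiteAutomorphism P
      automorphism = record
        { automorphism = record
          { bijection = mk↔ₛ′ limit (proj₁ ∘ hit) (proj₂ ∘ hit) (λ v → limit-injective (proj₂ (hit (limit v))))
          ; adjacency = λ _ _ → mk⇔ limit-~ limit-~⁻ }
        ; preserves = limit-part }

    connected-homogeneous : ConnectedHomogeneous Γ P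
    connected-homogeneous A B A-connected _ φ φ-part with em {∃[ v ] v ∈ FiniteSubset.elements A}
    ... | no empty = record { automorphism = ≅-refl ; preserves = λ _ → refl } ,
                     λ (a , a∈) → ⊥-elim (empty (a , a∈))
    ... | yes (root , root∈) = L.automorphism , λ (a , a∈) → trans (L.limit-start a∈) (f-on a∈)
      where
      open FiniteSubset A
      module φ = Isomorphism φ
      f : Vertex Γ → Vertex Γ
      f v with em {v ∈ elements}
      ... | yes v∈ = proj₁ (φ.to (v , v∈))
      -- A dummy value: outside the domain nothing is required of `f`.
      ... | no _   = v
      f-on : ∀ {v} (v∈ : v ∈ elements) → f v ≡ proj₁ (φ.to (v , v∈))
      f-on {v} v∈ with em {v ∈ elements}
      ... | yes v∈′ = cong (λ m → proj₁ (φ.to (v , m))) (unique⇒irrelevant unique v∈′ v∈)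
      ... | no v∉   = ⊥-elim (v∉ v∈)
      start : Stage
      start = record { dom = elements ; fun = f ; emb = record
        { injective = λ u∈ v∈ eq → cong proj₁ (φ.to-injective (Σ-∈-≡ (FiniteSubset.unique B)
            (trans (sym (f-on u∈)) (trans eq (f-on v∈)))))
        ; adjacency = λ u∈ v∈ → mk⇔
            (λ e → subst₂ _~_ (sym (f-on u∈)) (sym (f-on v∈)) (φ.to-~ {_ , u∈} {_ , v∈} e))
            (λ e → φ.to-~⁻ {_ , u∈} {_ , v∈} (subst₂ _~_ (f-on u∈) (f-on v∈) e))
        ; preserves = λ v∈ → trans (cong part (f-on v∈)) (φ-part (_ , v∈))
        ; linked = λ u∈ v∈ → gmap proj₁ (λ {u} {v} e → e , proj₂ u , proj₂ v) (A-connected (_ , u∈) (_ , v∈)) } }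
      module L = Limit start root∈

    homogeneous-bipartite : LocallyFinite Γ × IsConnectedHomogeneousBipartite Γ
    homogeneous-bipartite = (λ v → _ , has-degree v) , P , connected-homogeneous

  -- The parts alone decide adjacency, so any neighbour of `f a` not yet in the image will do.
  complete-extension : (∀ {u v} → part u ≢ part v → u ~ v) → OnePointExtension
  complete-extension complete {f = f} {v = v} emb a∈ av v∉ =
    let w , _ , w-part , fresh = outside-neighbour emb a∈ av v∉
    in w , w-part , fresh , λ {u} u∈ → mk⇔
      (λ vu → complete (subst₂ _≢_ (sym w-part) (sym (preserves u∈)) (proper vu)))
      (λ wfu → complete (subst₂ _≢_ w-part (preserves u∈) (proper wfu)))
    where open PartialEmbedding emb

  -- Two different neighbours of `x` in `B` would be joined by a path inside `B`, which `x` would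
  -- close.
  one-attachment : NoClosedPath → ∀ {B x p q} → x ∉ B → x ~ p → x ~ q → p ∈ B → Star (Inside B) p q → p ≡ q
  one-attachment none x∉ xp xq p∈ walk = decidable-stable em λ p≢q →
    let l , path , sub = walk⇒path em p∈ walk
    in none (go xp (x∉ ∘ sub) path) (~-sym xq) (s≤s (length-path path p≢q))

  -- By `one-attachment`, applied to `A` and to its image, `a` is the only neighbour of `v` in `A`
  -- and `f a` the only neighbour of `w` in the image, so those two edges account for all
  -- adjacencies.
  acyclic-extension : Acyclic Γ → OnePointExtension
  acyclic-extension acyclic {A} {f} {a} {v} emb a∈ av v∉ =
    let w , faw , w-part , fresh = outside-neighbour emb a∈ av v∉
    in w , w-part , fresh , λ {u} u∈ → mk⇔
      (λ vu → subst (λ u → w ~ f u) (one-attachment none v∉ (~-sym av) vu a∈ (linked a∈ u∈)) (~-sym faw))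
      (λ wfu → subst (v ~_)
        (injective a∈ u∈ (one-attachment none (w∉ fresh) (~-sym faw) wfu (∈-map⁺ f a∈) (image-linked a∈ u∈)))
        (~-sym av))
    where
    open PartialEmbedding emb
    none : NoClosedPath
    none = acyclic⇒no-closed-path acyclic
    w∉ : ∀ {w} → (∀ {u} → u ∈ A → f u ≢ w) → w ∉ map f A
    w∉ fresh w∈ with ∈-map⁻ f w∈
    ... | u , u∈ , eq = fresh u∈ (sym eq)
    image-linked : ∀ {u v} → u ∈ A → v ∈ A → Star (Inside (map f A)) (f u) (f v)
    image-linked u∈ v∈ = gmap f (λ (e , p , q) → hom p q e , ∈-map⁺ f p , ∈-map⁺ f q) (linked u∈ v∈)

  module _ (partner : Vertex Γ → Vertex Γ) (partner-involutive : ∀ v → partner (partner v) ≡ v)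
           (partner-part : ∀ v → part (partner v) ≢ part v)
           (adjacency : ∀ u v → u ~ v ⇔ (part u ≢ part v × v ≢ partner u)) where

    private
      ~⁺ : ∀ {u v} → part u ≢ part v → v ≢ partner u → u ~ v
      ~⁺ ne ne′ = Equivalence.from (adjacency _ _) (ne , ne′)

      ≁-partner : ∀ {u} → ¬ u ~ partner u
      ≁-partner e = proj₂ (Equivalence.to (adjacency _ _) e) refl

      partner-unique : ∀ {u v} → part u ≢ part v → ¬ u ~ v → v ≡ partner u
      partner-unique ne u≁v = decidable-stable em (u≁v ∘ ~⁺ ne)

      partner-swap : ∀ {u v} → u ≡ partner v → v ≡ partner u
      partner-swap refl = sym (partner-involutive _)

    -- A vertex v whose partner lies in A must go to the partner of its image.
    -- Otherwise v may go to any w such that neither w nor its partner is hit.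
    matching-extension : OnePointExtension
    matching-extension {A} {f} {a} {v} emb a∈ av v∉ with em {partner v ∈ A}
    ... | yes pv∈ = partner (f (partner v)) , w-part , fresh , λ u∈ → mk⇔ (adj u∈) (adj⁻ u∈)
      where
      open PartialEmbedding emb
      w-part : part (partner (f (partner v))) ≡ part v
      w-part = ≢-≢⇒≡ (partner-part _) (subst (_≢ part v) (sym (preserves pv∈)) (partner-part v))
      fresh : ∀ {u} → u ∈ A → f u ≢ partner (f (partner v))
      fresh {u} u∈ eq = v∉ (subst (_∈ A) (sym (trans (sym (partner-involutive v)) (sym u≡))) u∈)
        where
        u≡ : u ≡ partner (partner v)
        u≡ = partner-unique
          (λ eq′ → partner-part v (trans eq′ (trans (sym (preserves u∈)) (trans (cong part eq) w-part))))
          (λ e → ≁-partner (subst (f (partner v) ~_) eq (hom pv∈ u∈ e)))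
      adj : ∀ {u} → u ∈ A → v ~ u → partner (f (partner v)) ~ f u
      adj u∈ vu = ~⁺ (subst₂ _≢_ (sym w-part) (sym (preserves u∈)) (proper vu))
        (λ eq → ≁-partner (subst (v ~_) (injective u∈ pv∈ (trans eq (partner-involutive _))) vu))
      adj⁻ : ∀ {u} → u ∈ A → partner (f (partner v)) ~ f u → v ~ u
      adj⁻ u∈ e = ~⁺ (subst₂ _≢_ w-part (preserves u∈) (proper e))
        (λ { refl → ≁-partner (~-sym e) })
    ... | no pv∉ = choose (unhit-neighbour h (sym (preserves a∈)) av)
      where
      open PartialEmbedding emb
      -- `h` also takes the value forced on a vertex whose partner lies in `A`, so avoiding `h`
      -- keeps both `w` and its partner out of the image. Where neither a vertex nor its partner is
      -- in `A` the value is arbitrary; the count in `unhit-neighbour` tolerates it.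
      h : Vertex Γ → Vertex Γ
      h u with em {u ∈ A}
      ... | yes _ = f u
      ... | no _  = partner (f (partner u))
      h-in : ∀ {u} → u ∈ A → h u ≡ f u
      h-in {u} u∈ with em {u ∈ A}
      ... | yes _ = refl
      ... | no u∉ = ⊥-elim (u∉ u∈)
      h-partner : ∀ {u} → u ∈ A → h (partner u) ≡ partner (f u)
      h-partner {u} u∈ with em {partner u ∈ A}
      ... | no _    = cong (partner ∘ f) (partner-involutive u)
      ... | yes pu∈ = partner-unique
        (subst₂ _≢_ (sym (preserves u∈)) (sym (preserves pu∈)) (≢-sym (partner-part u)))
        (≁-partner ∘ hom⁻ u∈ pu∈)
      choose : ∃[ w ] f a ~ w × (∀ {u} → a ~ u → u ≢ v → h u ≢ w) →
               ∃[ w ] part w ≡ part v × (∀ {u} → u ∈ A → f u ≢ w) × (∀ {u} → u ∈ A → v ~ u ⇔ w ~ f u)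
      choose (w , faw , unhit) = w , w-part , fresh , λ u∈ → mk⇔ (adj u∈) (adj⁻ u∈)
        where
        w-part : part w ≡ part v
        w-part = ≢-≢⇒≡ (≢-sym (proper faw)) (subst (_≢ part v) (sym (preserves a∈)) (proper av))
        fresh : ∀ {u} → u ∈ A → f u ≢ w
        fresh u∈ refl = unhit (hom⁻ a∈ u∈ faw) (λ { refl → v∉ u∈ }) (h-in u∈)
        partner-fresh : ∀ {u} → u ∈ A → f u ≢ partner w
        partner-fresh {u} u∈ eq = unhit a~pu
          (λ pu≡v → pv∉ (subst (_∈ A) (partner-swap (sym pu≡v)) u∈))
          (trans (h-partner u∈) (trans (cong partner eq) (partner-involutive w)))
          where
          same : part a ≡ part u
          same = trans (sym (preserves a∈)) (trans
            (≢-≢⇒≡ (proper faw) (≢-sym (partner-part w)))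
            (trans (sym (cong part eq)) (preserves u∈)))
          a~pu : a ~ partner u
          a~pu = ~⁺ (λ eq′ → partner-part u (trans (sym eq′) same))
            (λ pu≡pa → ≁-partner (~-sym (subst (_~ w)
              (trans (cong f (trans (sym (partner-involutive a)) (trans (cong partner (sym pu≡pa)) (partner-involutive u)))) eq) faw)))
        adj : ∀ {u} → u ∈ A → v ~ u → w ~ f u
        adj u∈ vu = ~⁺ (subst₂ _≢_ (sym w-part) (sym (preserves u∈)) (proper vu)) (partner-fresh u∈)
        adj⁻ : ∀ {u} → u ∈ A → w ~ f u → v ~ u
        adj⁻ u∈ e = ~⁺ (subst₂ _≢_ w-part (preserves u∈) (proper e)) (λ { refl → pv∉ u∈ })

-- Homogeneity of complete bipartite graphs, complements of perfect matchings and trees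

pullback : ∀ {ℓ₁ ℓ₂} {G : Graph ℓ₁} {H : Graph ℓ₂} → G ≅ H → Bipartition H → Bipartition G
pullback ι P = record { part = Bipartition.part P ∘ to ; proper = Bipartition.proper P ∘ to-~ }
  where open Isomorphism ι

hasDegree-pullback : ∀ {ℓ₁ ℓ₂} {G : Graph ℓ₁} {H : Graph ℓ₂} (ι : G ≅ H) {v d} →
                     HasDegree H (_≅_.to ι v) d → HasDegree G v d
hasDegree-pullback {G = G} ι {v} {d} deg =
  subst (λ v → HasDegree G v d) (Isomorphism.from∘to ι v) (hasDegree-≅ (≅-sym ι) deg)

module Bipartite (m n : ℕ) (R : Fin m → Fin n → Set) where

  open Graph (BipartiteGraph m n R) using (_~_)

  side : Fin m ⊎ Fin n → Part
  side (inj₁ _) = X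
  side (inj₂ _) = Y

  sides : Bipartition (BipartiteGraph m n R)
  sides = record { part = side ; proper = λ {u} {v} → proper u v }
    where
    proper : ∀ u v → u ~ v → side u ≢ side v
    proper (inj₁ _) (inj₂ _) _ ()
    proper (inj₂ _) (inj₁ _) _ ()

  degree-left : ∀ {i d} (ns : List (Fin n)) → Unique ns → length ns ≡ d →
                (∀ j → j ∈ ns ⇔ R i j) → HasDegree (BipartiteGraph m n R) (inj₁ i) d
  degree-left {i} ns uniq len adj =
    map inj₂ ns , Unique.map⁺ (λ { refl → refl }) uniq , trans (length-map inj₂ ns) len , adj′
    where
    adj′ : ∀ u → u ∈ map inj₂ ns ⇔ inj₁ i ~ u
    adj′ (inj₁ j) = mk⇔ (λ u∈ → case (∈-map⁻ inj₂ u∈)) (λ ())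
      where
      case : ∃[ k ] k ∈ ns × inj₁ j ≡ inj₂ k → ⊥
      case (_ , _ , ())
    adj′ (inj₂ j) = mk⇔
      (λ u∈ → let k , k∈ , eq = ∈-map⁻ inj₂ u∈ in Equivalence.to (adj j) (subst (_∈ ns) (inj₂-inj (sym eq)) k∈))
      (λ r → ∈-map⁺ inj₂ (Equivalence.from (adj j) r))
      where
      inj₂-inj : ∀ {j k : Fin n} → inj₂ {A = Fin m} j ≡ inj₂ k → j ≡ k
      inj₂-inj refl = refl

  degree-right : ∀ {j d} (ns : List (Fin m)) → Unique ns → length ns ≡ d →
                 (∀ i → i ∈ ns ⇔ R i j) → HasDegree (BipartiteGraph m n R) (inj₂ j) d
  degree-right {j} ns uniq len adj =
    map inj₁ ns , Unique.map⁺ (λ { refl → refl }) uniq , trans (length-map inj₁ ns) len , adj′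
    where
    adj′ : ∀ u → u ∈ map inj₁ ns ⇔ inj₂ j ~ u
    adj′ (inj₂ i) = mk⇔ (λ u∈ → case (∈-map⁻ inj₁ u∈)) (λ ())
      where
      case : ∃[ k ] k ∈ ns × inj₂ i ≡ inj₁ k → ⊥
      case (_ , _ , ())
    adj′ (inj₁ i) = mk⇔
      (λ u∈ → let k , k∈ , eq = ∈-map⁻ inj₁ u∈ in Equivalence.to (adj i) (subst (_∈ ns) (inj₁-inj (sym eq)) k∈))
      (λ r → ∈-map⁺ inj₁ (Equivalence.from (adj i) r))
      where
      inj₁-inj : ∀ {j k : Fin m} → inj₁ {B = Fin n} j ≡ inj₁ k → j ≡ k
      inj₁-inj refl = refl

length-allFin : ∀ n → length (allFin n) ≡ n
length-allFin n = length-tabulate {n = n} id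

module Backward {ℓ : Level} (em : ExcludedMiddle ℓ) (Γ : Graph ℓ) (connected : Connected Γ) where

  open Graph Γ using (_~_; ~-sym; ~-irrefl)

  complete⇒homogeneous : ∀ {m n} → Γ ≅ CompleteBipartite m n →
                         LocallyFinite Γ × IsConnectedHomogeneousBipartite Γ
  complete⇒homogeneous {m} {n} ι = Extend.homogeneous-bipartite
    (complete-extension λ ne → to-~⁻ (opposite-sides _ _ ne))
    where
    open Isomorphism ι
    open Bipartite m n (λ _ _ → ⊤)
    open Graph (CompleteBipartite m n) using () renaming (_~_ to _~′_)
    degree : Part → ℕ
    degree X = n
    degree Y = m
    has-degree : ∀ z → HasDegree (CompleteBipartite m n) z (degree (side z))
    has-degree (inj₁ i) = degree-left (allFin n) (Unique.allFin⁺ n) (length-allFin n)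
      (λ j → mk⇔ (λ _ → tt) (λ _ → ∈-allFin j))
    has-degree (inj₂ j) = degree-right (allFin m) (Unique.allFin⁺ m) (length-allFin m)
      (λ i → mk⇔ (λ _ → tt) (λ _ → ∈-allFin i))
    opposite-sides : ∀ u v → side u ≢ side v → u ~′ v
    opposite-sides (inj₁ _) (inj₁ _) ne = ⊥-elim (ne refl)
    opposite-sides (inj₁ _) (inj₂ _) _  = tt
    opposite-sides (inj₂ _) (inj₁ _) _  = tt
    opposite-sides (inj₂ _) (inj₂ _) ne = ⊥-elim (ne refl)
    open OnePointExtensions em Γ connected (pullback ι sides) degree (λ v → hasDegree-pullback ι (has-degree (to v)))

  matching⇒homogeneous : ∀ {n η} → Γ ≅ ComplementOfPerfectMatching n η →
                         LocallyFinite Γ × IsConnectedHomogeneousBipartite Γ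
  matching⇒homogeneous {n} {η} ι = Extend.homogeneous-bipartite
    (matching-extension (from ∘ mate ∘ to)
      (λ v → trans (cong (from ∘ mate) (to∘from _)) (trans (cong from (mate-involutive _)) (from∘to v)))
      (λ v eq → mate-side (to v) (trans (cong side (sym (to∘from _))) eq))
      (λ u v → mk⇔
        (λ e → let ne , ne′ = Equivalence.to (mate-~ _ _) (to-~ e)
               in ne , λ eq → ne′ (trans (cong to eq) (to∘from _)))
        (λ (ne , ne′) → to-~⁻ (Equivalence.from (mate-~ _ _)
           (ne , λ eq → ne′ (trans (sym (from∘to v)) (cong from eq)))))))
    where
    open Isomorphism ι
    open Bipartite n n (λ x y → y ≢ η ⟨$⟩ʳ x)
    open Graph (ComplementOfPerfectMatching n η) using () renaming (_~_ to _~′_)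
    mate : Fin n ⊎ Fin n → Fin n ⊎ Fin n
    mate (inj₁ i) = inj₂ (η ⟨$⟩ʳ i)
    mate (inj₂ j) = inj₁ (η ⟨$⟩ˡ j)
    mate-involutive : ∀ z → mate (mate z) ≡ z
    mate-involutive (inj₁ i) = cong inj₁ (inverseˡ η)
    mate-involutive (inj₂ j) = cong inj₂ (inverseʳ η)
    mate-side : ∀ z → side (mate z) ≢ side z
    mate-side (inj₁ _) ()
    mate-side (inj₂ _) ()
    mate-~ : ∀ u v → u ~′ v ⇔ (side u ≢ side v × v ≢ mate u)
    mate-~ (inj₁ i) (inj₁ j) = mk⇔ (λ ()) (λ (ne , _) → ne refl)
    mate-~ (inj₁ i) (inj₂ j) = mk⇔ (λ ne → (λ ()) , λ { refl → ne refl }) (λ (_ , ne) eq → ne (cong inj₂ eq))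
    mate-~ (inj₂ j) (inj₁ i) = mk⇔ (λ ne → (λ ()) , λ { refl → ne (sym (inverseʳ η)) })
      (λ (_ , ne) eq → ne (cong inj₁ (trans (sym (inverseˡ η)) (cong (η ⟨$⟩ˡ_) (sym eq)))))
    mate-~ (inj₂ i) (inj₂ j) = mk⇔ (λ ()) (λ (ne , _) → ne refl)
    others : ∀ {n} → Fin n → List (Fin n)
    others {suc n} i = map (punchIn i) (allFin n)
    others-unique : ∀ {n} (i : Fin n) → Unique (others i)
    others-unique {suc n} i = Unique.map⁺ (Fin.punchIn-injective i _ _) (Unique.allFin⁺ n)
    length-others : ∀ {n} (i : Fin n) → length (others i) ≡ pred n
    length-others {suc n} i = trans (length-map (punchIn i) (allFin n)) (length-allFin n)
    ∈-others⁻ : ∀ {n} {i j : Fin n} → j ∈ others i → j ≢ i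
    ∈-others⁻ {suc n} {i} j∈ eq with ∈-map⁻ (punchIn i) j∈
    ... | k , _ , refl = Fin.punchInᵢ≢i i k eq
    ∈-others⁺ : ∀ {n} {i j : Fin n} → j ≢ i → j ∈ others i
    ∈-others⁺ {suc n} {i} {j} ne = subst (_∈ others i) (Fin.punchIn-punchOut (≢-sym ne))
      (∈-map⁺ (punchIn i) (∈-allFin (punchOut (≢-sym ne))))
    has-degree : ∀ z → HasDegree (ComplementOfPerfectMatching n η) z (pred n)
    has-degree (inj₁ i) = degree-left (others (η ⟨$⟩ʳ i)) (others-unique (η ⟨$⟩ʳ i)) (length-others (η ⟨$⟩ʳ i))
      (λ j → mk⇔ ∈-others⁻ ∈-others⁺)
    has-degree (inj₂ j) = degree-right (others (η ⟨$⟩ˡ j)) (others-unique (η ⟨$⟩ˡ j)) (length-others (η ⟨$⟩ˡ j))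
      (λ i → mk⇔ (λ i∈ eq → ∈-others⁻ i∈ (trans (sym (inverseˡ η)) (cong (η ⟨$⟩ˡ_) (sym eq))))
                 (λ ne → ∈-others⁺ λ { refl → ne (sym (inverseʳ η)) }))
    open OnePointExtensions em Γ connected (pullback ι sides) (λ _ → pred n)
      (λ v → hasDegree-pullback ι (has-degree (to v)))

  tree⇒homogeneous : ∀ {a b} {T : Graph ℓ} → IsInfiniteSemiregularTree a b T → Γ ≅ T →
                     LocallyFinite Γ × IsConnectedHomogeneousBipartite Γ
  tree⇒homogeneous {a} {b} {T} (_ , acyclic , _ , P , degX , degY) ι =
    Extend.homogeneous-bipartite (acyclic-extension λ m 3≤m (f , inj , adj) →
      acyclic m 3≤m (to ∘ f , inj ∘ to-injective , λ i j e → to-~ (adj i j e)))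
    where
    open Isomorphism ι
    degree : Part → ℕ
    degree X = a
    degree Y = b
    has-degree : ∀ v p → Bipartition.part P v ≡ p → HasDegree T v (degree p)
    has-degree v X = degX v
    has-degree v Y = degY v
    open OnePointExtensions em Γ connected (pullback ι P) degree
      (λ v → hasDegree-pullback ι (has-degree (to v) _ refl))

-- Homogeneity of even cycles

module CycleSymmetry (n : ℕ) (3≤m : 3 ≤ suc n) where

  open CyclicOrder n

  C : Graph 0ℓ
  C = Cycle (suc n) 3≤m

  open Graph C using (_~_)

  neighbour-of : ∀ {i j} → i ~ j → j ≡ next i ⊎ j ≡ prev i
  neighbour-of (inj₁ nx) = inj₁ (Next-functional nx (Next-next _))
  neighbour-of (inj₂ nx) = inj₂ (Next-injective nx (Next-prev _))

  has-degree : ∀ i → HasDegree C i 2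
  has-degree i = next i ∷ prev i ∷ [] , (next≢prev 3≤m i ∷ []) ∷ [] ∷ [] , refl , λ u → mk⇔
    (λ { (here refl) → inj₁ (Next-next i) ; (there (here refl)) → inj₂ (Next-prev i) })
    (λ e → [ here , there ∘ here ]′ (neighbour-of e))

  next-prev : ∀ i → next (prev i) ≡ i
  next-prev i = Next-functional (Next-next (prev i)) (Next-prev i)

  prev-next : ∀ i → prev (next i) ≡ i
  prev-next i = Next-injective (Next-prev (next i)) (Next-next i)

  next-Next : ∀ {i j} → Next (suc n) i j → Next (suc n) (next i) (next j)
  next-Next {i} nx = subst (λ k → Next (suc n) (next i) (next k))
                       (Next-functional (Next-next i) nx) (Next-next (next i))

  next-Next⁻ : ∀ {i j} → Next (suc n) (next i) (next j) → Next (suc n) i j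
  next-Next⁻ {i} {j} nx = subst (Next (suc n) i) eq (Next-next i)
    where
    eq : next i ≡ j
    eq = trans (sym (prev-next (next i))) (trans (cong prev (Next-functional (Next-next (next i)) nx)) (prev-next j))

  rotation : C ≅ C
  rotation = record
    { bijection = mk↔ₛ′ next prev next-prev prev-next
    ; adjacency = λ _ _ → mk⇔
        [ inj₁ ∘ next-Next , inj₂ ∘ next-Next ]′ [ inj₁ ∘ next-Next⁻ , inj₂ ∘ next-Next⁻ ]′ }

  opposite-Next : ∀ {i j} → Next (suc n) i j → Next (suc n) (opposite j) (opposite i)
  opposite-Next {i} {j} (inj₁ p) = inj₁
    (trans (cong suc (trans (Fin.opposite-prop j) (cong (n ∸_) (sym p))))
    (trans (sym (ℕ.+-∸-assoc 1 (subst (_≤ n) (sym p) (Fin.toℕ≤pred[n] j)))) (sym (Fin.opposite-prop i))))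
  opposite-Next {i} {j} (inj₂ (p , q)) = inj₂
    ( cong suc (trans (Fin.opposite-prop j) (cong (n ∸_) q))
    , trans (Fin.opposite-prop i) (trans (cong (n ∸_) (ℕ.suc-injective p)) (ℕ.n∸n≡0 n)))

  opposite-Next⁻ : ∀ {i j} → Next (suc n) (opposite i) (opposite j) → Next (suc n) j i
  opposite-Next⁻ {i} {j} nx = subst₂ (Next (suc n)) (Fin.opposite-involutive j) (Fin.opposite-involutive i) (opposite-Next nx)

  reflection : C ≅ C
  reflection = record
    { bijection = mk↔ₛ′ opposite opposite Fin.opposite-involutive Fin.opposite-involutive
    ; adjacency = λ _ _ → mk⇔
        [ inj₂ ∘ opposite-Next , inj₁ ∘ opposite-Next ]′ [ inj₂ ∘ opposite-Next⁻ , inj₁ ∘ opposite-Next⁻ ]′ }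

  power : ℕ → C ≅ C
  power zero    = ≅-refl
  power (suc k) = ≅-trans (power k) rotation

  power-Next : ∀ k {i j} → Next (suc n) i j → Next (suc n) (_≅_.to (power k) i) (_≅_.to (power k) j)
  power-Next zero    nx = nx
  power-Next (suc k) nx = next-Next (power-Next k nx)

  power-zero : ∀ i → _≅_.to (power (toℕ i)) zero ≡ i
  power-zero = <-weakInduction _ refl λ i ih → Next-functional
    (Next-next _)
    (subst (λ k → Next (suc n) k (suc i))
      (trans (sym ih) (cong (λ k → _≅_.to (power k) zero) (Fin.toℕ-inject₁ i))) (inject₁-suc i))

  -- A power of the rotation takes `zero` to `i`. For a backward arc it is preceded by the
  -- reflection followed by one rotation, which fixes `zero` and exchanges its two neighbours.
  arc : ∀ {i j} → i ~ j → Σ[ g ∈ C ≅ C ] _≅_.to g zero ≡ i × _≅_.to g (next zero) ≡ j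
  arc {i} (inj₁ nx) = power (toℕ i) , power-zero i ,
    Next-functional (subst (λ k → Next (suc n) k (_≅_.to (power (toℕ i)) (next zero))) (power-zero i) (power-Next (toℕ i) (Next-next zero))) nx
  arc {i} (inj₂ nx) = ≅-trans (≅-trans reflection rotation) (power (toℕ i)) ,
    trans (cong (_≅_.to (power (toℕ i))) last-next) (power-zero i) ,
    Next-injective (subst (Next (suc n) _) (trans (cong (_≅_.to (power (toℕ i))) last-next) (power-zero i))
      (power-Next (toℕ i) (next-Next (opposite-Next (Next-next zero))))) nx
    where
    last-next : next last ≡ zero
    last-next = Next-functional (Next-next last) last-zero

  parity : 2 ∣ suc n → Bipartition C
  parity even = record { part = λ i → flips (toℕ i) X ; proper =
    λ { (inj₁ nx) eq → alternate nx eq ; (inj₂ nx) eq → alternate nx (sym eq) } }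
    where
    alternate : ∀ {i j} → Next (suc n) i j → flips (toℕ i) X ≢ flips (toℕ j) X
    alternate {i} {j} (inj₁ p) eq = other-≢ (flips (toℕ i) X) (trans (cong (λ k → flips k X) p) (sym eq))
    -- The closing edge from `n` to `zero` is where the evenness of the length enters.
    alternate {i} {j} (inj₂ (p , q)) eq = other-≢ (flips (toℕ i) X)
      (trans (trans (cong (λ k → flips k X) p) (even⇒flips (suc n) even))
             (trans (sym (cong (λ k → flips k X) q)) (sym eq)))

module CycleHomogeneity {ℓ : Level} (em : ExcludedMiddle ℓ) (Γ : Graph ℓ) (connected : Connected Γ)
    (n : ℕ) (3≤m : 3 ≤ suc n) (ι : Γ ≅ Cycle (suc n) 3≤m) where

  open Graph Γ using (_~_; ~-sym; ~-irrefl)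
  open CyclicOrder n
  open CycleSymmetry n 3≤m
  open Isomorphism ι

  arc-automorphism : ∀ {a a′ b b′} → a ~ a′ → b ~ b′ → Σ[ ψ ∈ Γ ≅ Γ ] _≅_.to ψ a ≡ b × _≅_.to ψ a′ ≡ b′
  arc-automorphism {a} {a′} {b} {b′} aa′ bb′ =
    let g , g0 , g1 = arc (to-~ aa′)
        h , h0 , h1 = arc (to-~ bb′)
        back = λ {i c} (eq : _≅_.to g i ≡ to c) → trans (cong (Isomorphism.from g) (sym eq)) (Isomorphism.from∘to g i)
    in ≅-trans (≅-trans (≅-trans ι (≅-sym g)) h) (≅-sym ι) ,
       trans (cong (from ∘ _≅_.to h) (back g0)) (trans (cong from h0) (from∘to b)) ,
       trans (cong (from ∘ _≅_.to h) (back g1)) (trans (cong from h1) (from∘to b′))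

  at-most-two : ∀ {v x y z} → v ~ x → v ~ y → v ~ z → x ≢ y → z ≡ x ⊎ z ≡ y
  at-most-two vx vy vz x≢y with neighbour-of (to-~ vx) | neighbour-of (to-~ vy) | neighbour-of (to-~ vz)
  ... | inj₁ p | inj₁ q | _      = ⊥-elim (x≢y (to-injective (trans p (sym q))))
  ... | inj₂ p | inj₂ q | _      = ⊥-elim (x≢y (to-injective (trans p (sym q))))
  ... | inj₁ p | inj₂ _ | inj₁ r = inj₁ (to-injective (trans r (sym p)))
  ... | inj₁ _ | inj₂ q | inj₂ r = inj₂ (to-injective (trans r (sym q)))
  ... | inj₂ _ | inj₁ q | inj₁ r = inj₂ (to-injective (trans r (sym q)))
  ... | inj₂ p | inj₁ _ | inj₂ r = inj₁ (to-injective (trans r (sym p)))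

  neighbour : ∀ v → ∃[ w ] v ~ w
  neighbour v = from (next (to v)) , to-~⁻ (inj₁ (subst (Next (suc n) (to v)) (sym (to∘from _)) (Next-next (to v))))

  module _ (P : Bipartition Γ) where

    open Bipartition P using (part; proper)

    -- The part of a vertex and the part of its image both switch along every edge, so agreement at
    -- one vertex spreads over the connected graph.
    preserves-everywhere : (ψ : Γ ≅ Γ) → ∀ {u v} → Star _~_ u v →
      part (_≅_.to ψ u) ≡ part u → part (_≅_.to ψ v) ≡ part v
    preserves-everywhere ψ ε        eq = eq
    preserves-everywhere ψ (e ◅ es) eq = preserves-everywhere ψ es
      (≢-≢⇒≡ (≢-sym (proper (Isomorphism.to-~ ψ e))) (subst (_≢ part _) (sym eq) (proper e)))

    connected-homogeneous : ConnectedHomogeneous Γ P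
    connected-homogeneous A B A-connected _ φ φ-part = by-cases em
      where
      open FiniteSubset A
      module φ = Isomorphism φ
      IA : Graph ℓ
      IA = induced Γ A

      Extension′ : Set ℓ
      Extension′ = Σ[ ψ ∈ BipartiteAutomorphism P ] (∀ a → BipartiteAutomorphism.to ψ (proj₁ a) ≡ proj₁ (φ.to a))

      bipartite : ∀ {ψ : Γ ≅ Γ} {a} → _≅_.to ψ (proj₁ a) ≡ proj₁ (φ.to a) → BipartiteAutomorphism P
      bipartite {ψ} {a} eq = record
        { automorphism = ψ
        ; preserves = λ v → preserves-everywhere ψ (connected (proj₁ a) v) (trans (cong part eq) (φ-part a)) }

      -- Two consecutive vertices on which ψ and φ agree determine the next one.
      agreement : ∀ (ψ : Γ ≅ Γ) {p p′ q} → Star (Graph._~_ IA) p q → Graph._~_ IA p p′ →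
        _≅_.to ψ (proj₁ p) ≡ proj₁ (φ.to p) → _≅_.to ψ (proj₁ p′) ≡ proj₁ (φ.to p′) →
        _≅_.to ψ (proj₁ q) ≡ proj₁ (φ.to q)
      agreement ψ ε _ eq _ = eq
      agreement ψ {p} {p′} (_◅_ {j = r} e es) e′ eq eq′ = agreement ψ es (~-sym e) agree-r eq
        where
        agree-r : _≅_.to ψ (proj₁ r) ≡ proj₁ (φ.to r)
        agree-r with em {proj₁ p′ ≡ proj₁ r}
        ... | yes p′≡r = subst (λ z → _≅_.to ψ (proj₁ z) ≡ proj₁ (φ.to z)) (Σ-∈-≡ unique p′≡r) eq′
        ... | no p′≢r with at-most-two (φ.to-~ {p} {p′} e′) (φ.to-~ {p} {r} e)
                             (subst (_~ _≅_.to ψ (proj₁ r)) eq (Isomorphism.to-~ ψ e))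
                             (λ φp′≡φr → p′≢r (cong proj₁ (φ.to-injective (Σ-∈-≡ (FiniteSubset.unique B) φp′≡φr))))
        ...   | inj₂ ψr≡φr  = ψr≡φr
        ...   | inj₁ ψr≡φp′ = ⊥-elim (p′≢r (Isomorphism.to-injective ψ (trans eq′ (sym ψr≡φp′))))

      by-edge : ∀ a → Dec (∃[ a′ ] Graph._~_ IA a a′) → Extension′
      by-edge a (yes (a′ , e)) =
        let ψ , ψa , ψa′ = arc-automorphism e (φ.to-~ {a} {a′} e)
        in bipartite {ψ} {a} ψa , λ q → agreement ψ (A-connected a q) e ψa ψa′
      -- Here `A` is a single vertex, and any arc leaving it may be taken to any arc leaving its
      -- image.
      by-edge a (no isolated) =
        let ψ , ψa , _ = arc-automorphism (proj₂ (neighbour (proj₁ a))) (proj₂ (neighbour (proj₁ (φ.to a))))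
        in bipartite {ψ} {a} ψa , λ q → subst (λ z → _≅_.to ψ (proj₁ z) ≡ proj₁ (φ.to z)) (only (A-connected a q)) ψa
        where
        only : ∀ {q} → Star (Graph._~_ IA) a q → a ≡ q
        only ε       = refl
        only (_◅_ {j = r} e _) = ⊥-elim (isolated (r , e))

      by-cases : Dec (Vertex IA) → Extension′
      by-cases (yes a)    = by-edge a em
      by-cases (no empty) = record { automorphism = ≅-refl ; preserves = λ _ → refl } , ⊥-elim ∘ empty

  homogeneous-bipartite : 2 ∣ suc n → LocallyFinite Γ × IsConnectedHomogeneousBipartite Γ
  homogeneous-bipartite even =
    (λ v → 2 , hasDegree-pullback ι (has-degree (to v))) ,
    pullback ι (parity even) , connected-homogeneous (pullback ι (parity even))

-- Assembly of the classification

module Forward {ℓ : Level} (em : ExcludedMiddle ℓ) (Γ : Graph ℓ) (P : Bipartition Γ)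
               (homogeneous : ConnectedHomogeneous Γ P)
               (connected : Connected Γ) (locally-finite : LocallyFinite Γ) where

  open Graph Γ using (_~_; ~-sym)
  open Classification em Γ P homogeneous connected locally-finite
  open WithoutSquare em Γ P homogeneous connected locally-finite
  open Sparse em Γ P homogeneous connected locally-finite

  Listed : Set (lsuc ℓ)
  Listed =
      (Σ[ m ∈ ℕ ] Σ[ 3≤m ∈ 3 ≤ m ] (2 ∣ m × Γ ≅ Cycle m 3≤m))
    ⊎ (Σ[ a ∈ ℕ ] Σ[ b ∈ ℕ ] Σ[ T ∈ Graph ℓ ] (IsInfiniteSemiregularTree a b T × Γ ≅ T))
    ⊎ (Σ[ m ∈ ℕ ] Σ[ n ∈ ℕ ] (Γ ≅ CompleteBipartite m n))
    ⊎ (Σ[ n ∈ ℕ ] Σ[ η ∈ Permutation′ n ] (Γ ≅ ComplementOfPerfectMatching n η))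

  listed : Listed
  listed with em {Vertex Γ}
  ... | no empty = inj₂ (inj₂ (inj₁ (empty⇒complete empty)))
  ... | yes v with em {∃[ u ] v ~ u}
  ...   | no isolated = inj₂ (inj₂ (inj₁ (isolated⇒complete v λ u e → isolated (u , e))))
  ...   | yes (u , e) with three-walks-close?
  ...     | inj₂ close = inj₂ (inj₂ (inj₁ (three-walks-close⇒complete e close)))
  ...     | inj₁ path with em {Square}
  ...       | yes square = inj₂ (inj₂ (inj₂ (WithSquare.complement-of-perfect-matching path square)))
  ...       | no no-square with em {∃ ThreeNeighbours} | em {Acyclic Γ}
  ...         | yes three   | _          = inj₂ (inj₁ (acyclic⇒tree (acyclic no-square three) path))
  -- Every vertex has exactly two neighbours, so this tree is the two-way infinite path.
  ...         | no no-three | yes acyc   = inj₂ (inj₁ (acyclic⇒tree acyc path))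
  ...         | no no-three | no cyclic  = inj₁ (cyclic⇒cycle no-three cyclic)

theorem4p6 : {ℓ : Level} → ExcludedMiddle ℓ →
    (Γ : Graph ℓ) → Connected Γ →
    (LocallyFinite Γ × IsConnectedHomogeneousBipartite Γ)
    ⇔
    ( (Σ[ m ∈ ℕ ] Σ[ 3≤m ∈ 3 ≤ m ] (2 ∣ m × Γ ≅ Cycle m 3≤m))
    ⊎ (Σ[ a ∈ ℕ ] Σ[ b ∈ ℕ ] Σ[ T ∈ Graph ℓ ] (IsInfiniteSemiregularTree a b T × Γ ≅ T))
    ⊎ (Σ[ m ∈ ℕ ] Σ[ n ∈ ℕ ] (Γ ≅ CompleteBipartite m n))
    ⊎ (Σ[ n ∈ ℕ ] Σ[ η ∈ Permutation′ n ] (Γ ≅ ComplementOfPerfectMatching n η)) )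
theorem4p6 em Γ connected = mk⇔
  (λ (locally-finite , P , homogeneous) → Forward.listed em Γ P homogeneous connected locally-finite)
  λ { (inj₁ (suc n , 3≤m , even , ι)) → CycleHomogeneity.homogeneous-bipartite em Γ connected n 3≤m ι even
    ; (inj₂ (inj₁ (_ , _ , _ , tree , ι))) → Backward.tree⇒homogeneous em Γ connected tree ι
    ; (inj₂ (inj₂ (inj₁ (_ , _ , ι)))) → Backward.complete⇒homogeneous em Γ connected ι
    ; (inj₂ (inj₂ (inj₂ (_ , η , ι)))) → Backward.matching⇒homogeneous em Γ connected {η = η} ι }
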